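{- Let $\mathbf{s}=(s_1,s_2,\ldots)$ be a sequence of positive integers. The polynomial $Q_1^{(\mathbf{s})}(x)$ is palindromic for all $\mathbf{s}$. For $n\ge2$, write $\frac{s_n}{s_{n-1}}=\frac{p}{q}$, where $p,q$ are positive integers with $\gcd(p,q)=1$. Then $Q_n^{(\mathbf{s})}(x)$ is palindromic if and only if $Q_{n-1}^{(\mathbf{s})}(x)$ is palindromic and $p\,e^*_{n-1}\equiv-1\pmod q$.
   Context: For a sequence $\mathbf{s}$ of positive integers and $n\ge1$, let $\mathbf{v}_i=(0,\ldots,0,s_i,s_{i+1},\ldots,s_n)\in\mathbb{R}^n$ (first $i-1$ coordinates zero) for $1\le i\le n$, and let $\Pi_n^{(\mathbf{s})}=\left\{\sum_{i=1}^n\alpha_i\mathbf{v}_i \mid 0\le\alpha_i<1\right\}$. The $n$th inflated $\mathbf{s}$-Eulerian polynomial is $Q_n^{(\mathbf{s})}(x)=\sum_{\lambda\in\Pi_n^{(\mathbf{s})}\cap\mathbb{Z}^n}x^{\lambda_n}$. A polynomial $P(x)=\sum_{k=0}^d a_kx^k$ with $a_d>0$ and $a_0\ne0$ is palindromic if $a_k=a_{d-k}$ for $0\le k\le d$. The $\mathbf{s}$-inversion sequences are $I_n^{(\mathbf{s})}=\{\mathbf{e}=(e_1,\ldots,e_n)\in\mathbb{Z}^n\mid 0\le e_i<s_i \text{ for } 1\le i\le n\}$. For $\mathbf{e}\in I_n^{(\mathbf{s})}$, an index $1\le i<n$ is an ascent of $\mathbf{e}$ if $\frac{e_i}{s_i}<\frac{e_{i+1}}{s_{i+1}}$,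 and $0$ is an ascent if $e_1>0$; $\mathrm{asc}\,\mathbf{e}$ is the number of ascents of $\mathbf{e}$. $\mathbf{e}^*=(e_1^*,\ldots,e_n^*)\in I_n^{(\mathbf{s})}$ denotes the inversion sequence which achieves the largest possible value of $\mathrm{asc}\,\mathbf{e}$ over $\mathbf{e}\in I_n^{(\mathbf{s})}$ and such that $e_n^*\le e_n$ for all $\mathbf{e}\in I_n^{(\mathbf{s})}$ with $\mathrm{asc}\,\mathbf{e}=\mathrm{asc}\,\mathbf{e}^*$, and which has the same property on prefixes: for every $1\le j<n$, $(e_1^*,\ldots,e_j^*)$ maximizes $s_j\,\mathrm{asc}\,\mathbf{e}-e_j$ over $\mathbf{e}\in I_j^{(\mathbf{s})}$. In particular $e_{n-1}^*$ is the smallest last entry among those elements of $I_{n-1}^{(\mathbf{s})}$ with the largest number of ascents. -}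

module Defs where

open import Data.Bool using (if_then_else_; true; false)
open import Data.Fin as Fin using (Fin; zero; suc; toℕ; fromℕ; inject₁; inject≤)
import Data.Fin.Properties as Fin
open import Data.Integer as ℤ using (ℤ; +_; -[1+_]; 0ℤ; 1ℤ)
import Data.Integer.Divisibility as ℤ
import Data.Integer.Properties as ℤ
open import Data.List using (List; []; _∷_; length; filter; upTo; allFin; cartesianProductWith)
import Data.List as List
open import Data.List.Membership.Propositional using (_∈_)
open import Data.List.Membership.Propositional.Properties
  using (∈-cartesianProductWith⁺; ∈-map⁺; ∈-upTo⁺; ∈-filter⁺; ∈-filter⁻)
open import Data.List.Relation.Unary.All using ([])
open import Data.List.Relation.Unary.AllPairs using ([]; _∷_)
open import Data.List.Relation.Unary.Any using (here)
open import Data.List.Relation.Unary.Unique.Propositional using (Unique)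
import Data.List.Relation.Unary.Unique.Propositional.Properties as Unique
open import Data.Nat as ℕ using (ℕ; zero; suc; NonZero; _≤_; _<_; z≤n; s≤s)
import Data.Nat.DivMod as ℕ
import Data.Nat.Properties as ℕ
open import Data.Product using (Σ-syntax; ∃; ∃-syntax; _×_; _,_; proj₁; proj₂)
open import Data.Rational as ℚ using (ℚ; 0ℚ; 1ℚ; _/_; toℚᵘ)
import Data.Rational.Properties as ℚ
open import Data.Rational.Solver using (module +-*-Solver)
open import Data.Rational.Unnormalised as ℚᵘ using (mkℚᵘ; *≡*; *≤*; *<*)
import Data.Rational.Unnormalised.Properties as ℚᵘ
open import Data.Sum using (_⊎_; inj₁; inj₂)
open import Data.Vec as Vec using (Vec; []; _∷_; lookup)
import Data.Vec.Properties as Vec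
open import Data.Vec.Functional using (Vector; init; last)
open import Function using (_∘_; _⇔_; mk⇔; Equivalence)
open import Relation.Binary.PropositionalEquality
  using (_≡_; _≢_; _≗_; refl; sym; trans; cong; cong₂; subst; subst₂; module ≡-Reasoning)
open import Relation.Nullary using (¬_; Dec; does; yes; no; contradiction; _×-dec_)
open import Relation.Nullary.Decidable using (map′)

open import Algebra.Properties.CommutativeMonoid.Sum ℚ.+-0-commutativeMonoid
  using (sum; sum-cong-≗)
import Algebra.Properties.CommutativeMonoid.Sum ℕ.+-0-commutativeMonoid as ℕΣ

infix 4 _≡_[mod_]

_≡_[mod_] : ℤ → ℤ → ℕ → Set
a ≡ b [mod q ] = + q ℤ.∣ a ℤ.- b

-- A polynomial with coefficients in ℕ is given by its coefficient sequence;
-- d is the degree.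
Palindromic : (ℕ → ℕ) → Set
Palindromic a = ∃[ d ] 0 < a d × (∀ k → d < k → a k ≡ 0)
                     × a 0 ≢ 0 × (∀ k → k ≤ d → a k ≡ a (d ℕ.∸ k))

-- Indices start at 0: the terms s₁, s₂, … of the sequence are s 0, s 1, …,
-- and likewise the i-th coordinate of a vector has index i - 1.
module _ (s : ℕ → ℕ) {{s≢0 : ∀ {i} → NonZero (s i)}} where

  v : ∀ {n} → Fin n → Vector ℤ n
  v i j = if does (i Fin.≤? j) then + s (toℕ j) else 0ℤ

  -- The rational points of Π. The vᵢ have integer entries and are linearly
  -- independent, so the real points of Π with integer coordinates have
  -- rational α and are all found here.
  Π : ∀ {n} → Vector ℚ n → Set
  Π {n} x = Σ[ α ∈ Vector ℚ n ] (∀ i → 0ℚ ℚ.≤ α i × α i ℚ.< 1ℚ)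
              × (∀ j → x j ≡ sum (λ i → α i ℚ.* (v i j / 1)))

  LatticePoint : ∀ {n} → Vec ℤ n → Set
  LatticePoint x = Π (λ j → lookup x j / 1)

  Inv : ∀ {n} → Vector ℕ n → Set
  Inv e = ∀ i → e i < s (toℕ i)

  -- Ascent positions 0 ≤ i < n are not shifted: position i ≥ 1 compares eᵢ and eᵢ₊₁.
  Ascent : ∀ {n} → Vector ℕ n → Fin n → Set
  Ascent e zero    = 0 < e zero
  Ascent e (suc i) = + e (inject₁ i) / s (toℕ i) ℚ.< + e (suc i) / s (suc (toℕ i))

  ascent? : ∀ {n} (e : Vector ℕ n) i → Dec (Ascent e i)
  ascent? e zero    = 0 ℕ.<? e zero
  ascent? e (suc i) = + e (inject₁ i) / s (toℕ i) ℚ.<? + e (suc i) / s (suc (toℕ i))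

  asc : ∀ {n} → Vector ℕ n → ℕ
  asc {n} e = length (filter (ascent? e) (allFin n))

  -- e is 𝐞*, for n = m + 1. In prefix, (e₁, …, eⱼ₊₁) is e′ and s j is sⱼ₊₁; the
  -- difference is taken in ℤ. Existence of 𝐞* is isStar-exists below.
  record IsStar {m} (e : Vector ℕ (suc m)) : Set where
    field
      inv      : Inv e
      asc-max  : ∀ (f : Vector ℕ (suc m)) → Inv f → asc f ≤ asc e
      last-min : ∀ (f : Vector ℕ (suc m)) → Inv f → asc f ≡ asc e → last e ≤ last f
      prefix   : ∀ j (j<m : j < m) → let e′ = λ i → e (inject≤ {n = suc m} i (s≤s (ℕ.<⇒≤ j<m))) in
                 ∀ (f : Vector ℕ (suc j)) → Inv f →
                 + s j ℤ.* + asc f ℤ.- + last f ℤ.≤ + s j ℤ.* + asc e′ ℤ.- + last e′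

  private
    s/ : ℕ → ℚ
    s/ j = + s j / 1

    partial : ∀ {n} → Vector ℚ n → Vector ℚ n
    partial α zero    = α zero
    partial α (suc j) = α zero ℚ.+ partial (α ∘ suc) j

    -- increments of β, starting from c
    δ : ∀ {n} → ℚ → Vector ℚ n → Vector ℚ n
    δ c β zero    = β zero ℚ.- c
    δ c β (suc i) = δ (β zero) (β ∘ suc) i

    solver₁ : ∀ a c → a ≡ (a ℚ.+ c) ℚ.- c
    solver₁ = +-*-Solver.solve 2 (λ a c → a := (a :+ c) :- c) refl
      where open +-*-Solver

    solver₂ : ∀ b c x → (b ℚ.- c) ℚ.+ (x ℚ.- b) ≡ x ℚ.- c
    solver₂ = +-*-Solver.solve 3 (λ b c x → (b :- c) :+ (x :- b) := x :- c) refl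
      where open +-*-Solver

    solver₃ : ∀ p a c → p ℚ.+ (a ℚ.+ c) ≡ (a ℚ.+ p) ℚ.+ c
    solver₃ = +-*-Solver.solve 3 (λ p a c → p :+ (a :+ c) := (a :+ p) :+ c) refl
      where open +-*-Solver

    δ-unique : ∀ {n} c (α β : Vector ℚ n) → (∀ j → partial α j ℚ.+ c ≡ β j) →
               ∀ i → α i ≡ δ c β i
    δ-unique c α β eq zero    = trans (solver₁ (α zero) c) (cong (ℚ._- c) (eq zero))
    δ-unique c α β eq (suc i) = δ-unique (β zero) (α ∘ suc) (β ∘ suc)
      (λ j → trans (cong (partial (α ∘ suc) j ℚ.+_) (sym (eq zero)))
              (trans (solver₃ (partial (α ∘ suc) j) (α zero) c) (eq (suc j)))) i

    partial-δ : ∀ {n} c (β : Vector ℚ n) j → partial (δ c β) j ≡ β j ℚ.- c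
    partial-δ c β zero    = refl
    partial-δ c β (suc j) = trans (cong (β zero ℚ.- c ℚ.+_) (partial-δ (β zero) (β ∘ suc) j))
                                  (solver₂ (β zero) c (β (suc j)))

    suc≤?suc : ∀ {n} (i j : Fin n) → does (suc i Fin.≤? suc j) ≡ does (i Fin.≤? j)
    suc≤?suc zero    j = refl
    suc≤?suc (suc i) j = refl

    sum-zero : ∀ {n} (α : Vector ℚ n) → sum (λ i → α i ℚ.* (0ℤ / 1)) ≡ 0ℚ
    sum-zero {zero}  α = refl
    sum-zero {suc n} α = cong₂ ℚ._+_ (ℚ.*-zeroʳ (α zero)) (sum-zero (α ∘ suc))

    sum-v : ∀ {n} (α : Vector ℚ n) j (c : ℤ) →
            sum (λ i → α i ℚ.* ((if does (i Fin.≤? j) then c else 0ℤ) / 1)) ≡ partial α j ℚ.* (c / 1)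
    sum-v {suc n} α zero    c = trans (cong (α zero ℚ.* (c / 1) ℚ.+_) (sum-zero (α ∘ suc)))
                                      (ℚ.+-identityʳ _)
    sum-v {suc n} α (suc j) c = trans
      (cong (α zero ℚ.* (c / 1) ℚ.+_)
        (trans (sum-cong-≗ (λ i → cong (λ b → α (suc i) ℚ.* ((if b then c else 0ℤ) / 1)) (suc≤?suc i j)))
               (sum-v (α ∘ suc) j c)))
      (sym (ℚ.*-distribʳ-+ (c / 1) (α zero) (partial (α ∘ suc) j)))

    toℚᵘ-/ : ∀ z d .{{_ : NonZero d}} → toℚᵘ (z / d) ℚᵘ.≃ (z ℚᵘ./ d)
    toℚᵘ-/ z (suc d) = ℚ.toℚᵘ-fromℚᵘ (mkℚᵘ z d)

    /-*-cancel : ∀ z d .{{_ : NonZero d}} → (z / d) ℚ.* (+ d / 1) ≡ z / 1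
    /-*-cancel z d@(suc d-1) = ℚ.toℚᵘ-injective (ℚᵘ.≃-trans (ℚ.toℚᵘ-homo-* (z / d) (+ d / 1))
      (ℚᵘ.≃-trans (ℚᵘ.*-cong (toℚᵘ-/ z d) (toℚᵘ-/ (+ d) 1))
      (ℚᵘ.≃-trans (*≡* eq) (ℚᵘ.≃-sym (toℚᵘ-/ z 1)))))
      where
      eq : (z ℤ.* + d) ℤ.* 1ℤ ≡ z ℤ.* (+ (d ℕ.* 1))
      eq = trans (ℤ.*-identityʳ _) (cong (λ k → z ℤ.* + k) (sym (ℕ.*-identityʳ d)))

    instance
      s/-pos : ∀ {j} → ℚ.Positive (s/ j)
      s/-pos {j} = ℚ.normalize-pos (s j) 1

    cancel : ∀ j {p q} → p ℚ.* s/ j ≡ q ℚ.* s/ j → p ≡ q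
    cancel j eq = ℚ.≤-antisym (ℚ.*-cancelʳ-≤-pos (s/ j) (ℚ.≤-reflexive eq))
                              (ℚ.*-cancelʳ-≤-pos (s/ j) (ℚ.≤-reflexive (sym eq)))

    module _ {n} (x : Vec ℤ n) where
      β : Vector ℚ n
      β j = lookup x j / s (toℕ j)

      α* : Vector ℚ n
      α* = δ 0ℚ β

      partial-of-point : ((α , _) : LatticePoint x) → ∀ j → partial α j ≡ β j
      partial-of-point (α , _ , eq) j = cancel (toℕ j) (trans (sym (sum-v α j (+ s (toℕ j))))
        (trans (sym (eq j)) (sym (/-*-cancel (lookup x j) (s (toℕ j))))))

      fromBounds : (∀ i → 0ℚ ℚ.≤ α* i × α* i ℚ.< 1ℚ) → LatticePoint x
      fromBounds b = α* , b , λ j → sym (trans (sum-v α* j (+ s (toℕ j)))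
        (trans (cong (ℚ._* s/ (toℕ j)) (trans (partial-δ 0ℚ β j) (ℚ.+-identityʳ (β j))))
               (/-*-cancel (lookup x j) (s (toℕ j)))))

      toBounds : LatticePoint x → ∀ i → 0ℚ ℚ.≤ α* i × α* i ℚ.< 1ℚ
      toBounds p@(α , b , _) i = subst (λ a → 0ℚ ℚ.≤ a × a ℚ.< 1ℚ)
        (δ-unique 0ℚ α β (λ j → trans (ℚ.+-identityʳ _) (partial-of-point p j)) i) (b i)

  latticePoint? : ∀ {n} (x : Vec ℤ n) → Dec (LatticePoint x)
  latticePoint? x = map′ (fromBounds x) (toBounds x)
    (Fin.all? (λ i → (0ℚ ℚ.≤? α* x i) ×-dec (α* x i ℚ.<? 1ℚ)))

  box : ∀ {n} → Vector ℕ n → List (Vec ℤ n)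
  box {zero}  b = [] ∷ []
  box {suc n} b = cartesianProductWith _∷_ (List.map +_ (upTo (b zero))) (box (b ∘ suc))

  -- The coordinates of a point of Π satisfy 0 ≤ λⱼ < j sⱼ, so that searching
  -- the box below misses no lattice point.
  latticePoints : ∀ n → List (Vec ℤ n)
  latticePoints n = filter latticePoint? (box (λ j → suc (toℕ j) ℕ.* s (toℕ j)))

  Q : (n : ℕ) .{{_ : NonZero n}} → ℕ → ℕ
  Q n@(suc _) k = length (filter (λ x → Vec.last x ℤ.≟ + k) (latticePoints n))

  private
    0≤partial : ∀ {n} (α : Vector ℚ n) → (∀ i → 0ℚ ℚ.≤ α i) → ∀ j → 0ℚ ℚ.≤ partial α j
    0≤partial α b zero    = b zero
    0≤partial α b (suc j) = ℚ.+-mono-≤ (b zero) (0≤partial (α ∘ suc) (b ∘ suc) j)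

    1+ : ∀ k → 1ℚ ℚ.+ (+ suc k / 1) ≡ + suc (suc k) / 1
    1+ k = ℚ.toℚᵘ-injective (ℚᵘ.≃-trans (ℚ.toℚᵘ-homo-+ 1ℚ (+ suc k / 1))
      (ℚᵘ.≃-trans (ℚᵘ.+-congʳ (toℚᵘ 1ℚ) (toℚᵘ-/ (+ suc k) 1))
      (ℚᵘ.≃-trans (*≡* (cong (λ z → + (suc z) ℤ.* 1ℤ) (ℕ.*-identityʳ (suc k))))
                  (ℚᵘ.≃-sym (toℚᵘ-/ (+ suc (suc k)) 1)))))

    partial< : ∀ {n} (α : Vector ℚ n) → (∀ i → α i ℚ.< 1ℚ) → ∀ j → partial α j ℚ.< + suc (toℕ j) / 1
    partial< α b zero    = b zero
    partial< α b (suc j) = subst (partial α (suc j) ℚ.<_) (1+ (toℕ j))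
      (ℚ.+-mono-< (b zero) (partial< (α ∘ suc) (b ∘ suc) j))

    /-≤ : ∀ {a b : ℤ} {c d} .{{_ : NonZero c}} .{{_ : NonZero d}} →
          a / c ℚ.≤ b / d → a ℤ.* + d ℤ.≤ b ℤ.* + c
    /-≤ {a} {b} {c@(suc _)} {d@(suc _)} le
      with *≤* p ← ℚᵘ.≤-respʳ-≃ (toℚᵘ-/ b d) (ℚᵘ.≤-respˡ-≃ (toℚᵘ-/ a c) (ℚ.toℚᵘ-mono-≤ le)) = p

    /-< : ∀ {a b : ℤ} {c d} .{{_ : NonZero c}} .{{_ : NonZero d}} →
          a / c ℚ.< b / d → a ℤ.* + d ℤ.< b ℤ.* + c
    /-< {a} {b} {c@(suc _)} {d@(suc _)} lt
      with *<* p ← ℚᵘ.<-respʳ-≃ (toℚᵘ-/ b d) (ℚᵘ.<-respˡ-≃ (toℚᵘ-/ a c) (ℚ.toℚᵘ-mono-< lt)) = p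

    </ : ∀ {a b : ℤ} {c d} .{{_ : NonZero c}} .{{_ : NonZero d}} →
         a ℤ.* + d ℤ.< b ℤ.* + c → a / c ℚ.< b / d
    </ {a} {b} {c@(suc _)} {d@(suc _)} lt = ℚ.toℚᵘ-cancel-<
      (ℚᵘ.<-respʳ-≃ (ℚᵘ.≃-sym (toℚᵘ-/ b d)) (ℚᵘ.<-respˡ-≃ (ℚᵘ.≃-sym (toℚᵘ-/ a c)) (*<* lt)))

    nat : ∀ {z : ℤ} {b} → 0ℤ ℤ.≤ z → z ℤ.< + b → ∃[ k ] k < b × z ≡ + k
    nat {+ k}      _  (ℤ.+<+ k<b) = k , k<b , refl
    nat { -[1+ k ]} () _

    ∈-box : ∀ {n} (b : Vector ℕ n) x → (∀ j → ∃[ k ] k < b j × lookup x j ≡ + k) → x ∈ box b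
    ∈-box b []      _ = here refl
    ∈-box b (z ∷ x) p with k , k<b , refl ← p zero =
      ∈-cartesianProductWith⁺ _∷_ (∈-map⁺ +_ (∈-upTo⁺ k<b)) (∈-box (b ∘ suc) x (p ∘ suc))

    box-unique : ∀ {n} (b : Vector ℕ n) → Unique (box b)
    box-unique {zero}  b = [] ∷ []
    box-unique {suc n} b = Unique.cartesianProductWith⁺ _∷_ Vec.∷-injective
      (Unique.map⁺ ℤ.+-injective (Unique.upTo⁺ (b zero))) (box-unique (b ∘ suc))

    coord : ∀ {n} (x : Vec ℤ n) → LatticePoint x →
            ∀ j → ∃[ k ] k < suc (toℕ j) ℕ.* s (toℕ j) × lookup x j ≡ + k
    coord x p@(α , b , _) j = nat lo hi
      where
      eq = partial-of-point x p j
      lo : 0ℤ ℤ.≤ lookup x j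
      lo = subst (0ℤ ℤ.≤_) (ℤ.*-identityʳ (lookup x j))
        (/-≤ {0ℤ} {lookup x j} {1} {s (toℕ j)} (subst (0ℚ ℚ.≤_) eq (0≤partial α (proj₁ ∘ b) j)))
      hi : lookup x j ℤ.< + (suc (toℕ j) ℕ.* s (toℕ j))
      hi = subst₂ ℤ._<_ (ℤ.*-identityʳ (lookup x j)) (sym (ℤ.pos-* (suc (toℕ j)) (s (toℕ j))))
        (/-< {lookup x j} {+ suc (toℕ j)} {s (toℕ j)} {1}
          (subst (ℚ._< (+ suc (toℕ j) / 1)) eq (partial< α (proj₂ ∘ b) j)))

  ∈-latticePoints : ∀ {n} (x : Vec ℤ n) → x ∈ latticePoints n ⇔ LatticePoint x
  ∈-latticePoints {n} x = mk⇔
    (λ x∈ → proj₂ (∈-filter⁻ latticePoint? {xs = box _} x∈))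
    (λ p → ∈-filter⁺ latticePoint? (∈-box _ x (coord x p)) p)

  latticePoints-unique : ∀ n → Unique (latticePoints n)
  latticePoints-unique n = Unique.filter⁺ latticePoint? (box-unique _)

  private
    ind : ∀ {P : Set} → Dec P → ℕ
    ind P? = if does P? then 1 else 0

    ind-cong : ∀ {P R : Set} (P? : Dec P) (R? : Dec R) → (P → R) → (R → P) → ind P? ≡ ind R?
    ind-cong (yes p) (yes r) _ _ = refl
    ind-cong (yes p) (no ¬r) f _ = contradiction (f p) ¬r
    ind-cong (no ¬p) (yes r) _ g = contradiction (g r) ¬p
    ind-cong (no ¬p) (no ¬r) _ _ = refl

    ind-yes : ∀ {P : Set} (P? : Dec P) → P → ind P? ≡ 1
    ind-yes (yes _) _ = refl
    ind-yes (no ¬p) p = contradiction p ¬p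

    ind≤1 : ∀ {P : Set} (P? : Dec P) → ind P? ≤ 1
    ind≤1 (yes _) = s≤s z≤n
    ind≤1 (no _)  = z≤n

    count : ∀ {A : Set} {P : A → Set} (P? : ∀ a → Dec (P a)) {n} (f : Fin n → A) →
            length (filter P? (List.tabulate f)) ≡ ℕΣ.sum (λ i → ind (P? (f i)))
    count P? {zero}  f = refl
    count P? {suc n} f with P? (f zero)
    ... | yes _ = cong suc (count P? (f ∘ suc))
    ... | no  _ = count P? (f ∘ suc)

    asc-sum : ∀ {n} (e : Vector ℕ n) → asc e ≡ ℕΣ.sum (λ i → ind (ascent? e i))
    asc-sum e = count (ascent? e) (λ i → i)

    ascent-cong : ∀ {n} {e f : Vector ℕ n} → e ≗ f → ∀ i → Ascent e i → Ascent f i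
    ascent-cong eq zero    = subst (0 <_) (eq zero)
    ascent-cong eq (suc i) = subst₂ (λ a b → + a / s (toℕ i) ℚ.< + b / s (suc (toℕ i)))
                               (eq (inject₁ i)) (eq (suc i))

    asc-cong : ∀ {n} {e f : Vector ℕ n} → e ≗ f → asc e ≡ asc f
    asc-cong {e = e} {f} eq = trans (asc-sum e) (trans
      (ℕΣ.sum-cong-≗ (λ i → ind-cong (ascent? e i) (ascent? f i)
        (ascent-cong eq i) (ascent-cong (sym ∘ eq) i))) (sym (asc-sum f)))

    ascent-init : ∀ {n} (e : Vector ℕ (suc n)) i → Ascent (init e) i ⇔ Ascent e (inject₁ i)
    ascent-init e zero    = mk⇔ (λ a → a) (λ a → a)
    ascent-init e (suc i) = mk⇔ (subst P (sym (Fin.toℕ-inject₁ i))) (subst P (Fin.toℕ-inject₁ i))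
      where
      P : ℕ → Set
      P k = + e (inject₁ (inject₁ i)) / s k ℚ.< + e (suc (inject₁ i)) / s (suc k)

    asc-init : ∀ {n} (e : Vector ℕ (suc n)) → asc e ≡ asc (init e) ℕ.+ ind (ascent? e (fromℕ n))
    asc-init {n} e = trans (asc-sum e) (trans (ℕΣ.sum-init-last (λ i → ind (ascent? e i)))
      (cong (ℕ._+ ind (ascent? e (fromℕ n))) (trans
        (ℕΣ.sum-cong-≗ (λ i → ind-cong (ascent? e (inject₁ i)) (ascent? (init e) i)
          (Equivalence.from (ascent-init e i)) (Equivalence.to (ascent-init e i))))
        (sym (asc-sum (init e))))))

    E-next : ℕ → ℕ → ℕ
    E-next c t with c ℕ.<? t
    ... | yes _ = c
    ... | no  _ = 0

    -- the least c with a/s k < c/s (k+1)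
    E-cand : ℕ → ℕ → ℕ
    E-cand k a = suc ((a ℕ.* s (suc k)) ℕ./ s k)

    E : ℕ → ℕ
    E zero    = E-next 1 (s 0)
    E (suc k) = E-next (E-cand k (E k)) (s (suc k))

    E-next< : ∀ c t .{{_ : NonZero t}} → E-next c t < t
    E-next< c t with c ℕ.<? t
    ... | yes c<t = c<t
    ... | no  _   = ℕ.>-nonZero⁻¹ t

    E<s : ∀ k → E k < s k
    E<s zero    = E-next< 1 (s 0)
    E<s (suc k) = E-next< (E-cand k (E k)) (s (suc k))

    E-asc : ∀ k a → a ℕ.* s (suc k) < E-cand k a ℕ.* s k
    E-asc k a = begin-strict
      m                            ≡⟨ ℕ.m≡m%n+[m/n]*n m d ⟩
      m ℕ.% d ℕ.+ m ℕ./ d ℕ.* d    <⟨ ℕ.+-monoˡ-< (m ℕ./ d ℕ.* d) (ℕ.m%n<n m d) ⟩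
      d ℕ.+ m ℕ./ d ℕ.* d          ∎
      where
      open ℕ.≤-Reasoning
      m = a ℕ.* s (suc k)
      d = s k

    E-least : ∀ k a c → a ℕ.* s (suc k) < c ℕ.* s k → E-cand k a ≤ c
    E-least k a c lt = ℕ.m<n*o⇒m/o<n {o = s k} lt

    toℤ : ∀ {a b c d} → a ℕ.* b < c ℕ.* d → + a ℤ.* + b ℤ.< + c ℤ.* + d
    toℤ {a} {b} {c} {d} lt = subst₂ ℤ._<_ (ℤ.pos-* a b) (ℤ.pos-* c d) (ℤ.+<+ lt)

    fromℤ : ∀ {a b c d} → + a ℤ.* + b ℤ.< + c ℤ.* + d → a ℕ.* b < c ℕ.* d
    fromℤ {a} {b} {c} {d} lt =
      ℤ.drop‿+<+ (subst₂ ℤ._<_ (sym (ℤ.pos-* a b)) (sym (ℤ.pos-* c d)) lt)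

    Better : ∀ {m} → Vector ℕ (suc m) → Vector ℕ (suc m) → Set
    Better e f = asc f < asc e ⊎ (asc f ≡ asc e × last e ≤ last f)

    Best : ∀ {m} → Vector ℕ (suc m) → Set
    Best e = ∀ f → Inv f → Better e f

    last-asc : ∀ {m} (f : Vector ℕ (suc (suc m))) → Ascent f (fromℕ (suc m)) ⇔
               last (init f) ℕ.* s (suc m) < last f ℕ.* s m
    last-asc {m} f = mk⇔
      (λ a → subst (λ k → last (init f) ℕ.* s (suc k) < last f ℕ.* s k) (Fin.toℕ-fromℕ m)
               (fromℤ {last (init f)} {s (suc (toℕ (fromℕ m)))} {last f}
                 (/-< {+ last (init f)} {+ last f} {s (toℕ (fromℕ m))} a)))
      (λ lt → </ {+ last (init f)} {+ last f} {s (toℕ (fromℕ m))}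
               (toℤ {last (init f)} {_} {last f} (subst (λ k → last (init f) ℕ.* s (suc k) < last f ℕ.* s k)
                 (sym (Fin.toℕ-fromℕ m)) lt)))

    inv-init : ∀ {m} {f : Vector ℕ (suc m)} → Inv f → Inv (init f)
    inv-init {f = f} p i = subst (λ k → f (inject₁ i) < s k) (Fin.toℕ-inject₁ i) (p (inject₁ i))

    -- A, A′ count the ascents of two prefixes with last entries a, a′; i, i′
    -- say whether the new entries c, c′ add an ascent.
    step-lemma : ∀ k {A A′ a a′ c′ i i′} →
      c′ < s (suc k) → A′ < A ⊎ (A′ ≡ A × a ≤ a′) → i′ ≤ 1 →
      (a′ ℕ.* s (suc k) < c′ ℕ.* s k ⊎ i′ ≡ 0) →
      let c = E-next (E-cand k a) (s (suc k)) in
      (a ℕ.* s (suc k) < c ℕ.* s k → i ≡ 1) →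
      A′ ℕ.+ i′ < A ℕ.+ i ⊎ (A′ ℕ.+ i′ ≡ A ℕ.+ i × c ≤ c′)
    step-lemma k {A} {A′} {a} {a′} {c′} {i} {i′} c′<t H i′≤1 up E-up
      with E-cand k a ℕ.<? s (suc k)
    ... | yes c<t rewrite E-up (E-asc k a) = go H up
      where
      go : A′ < A ⊎ (A′ ≡ A × a ≤ a′) → (a′ ℕ.* s (suc k) < c′ ℕ.* s k ⊎ i′ ≡ 0) →
           A′ ℕ.+ i′ < A ℕ.+ 1 ⊎ (A′ ℕ.+ i′ ≡ A ℕ.+ 1 × E-cand k a ≤ c′)
      go (inj₁ lt) _ = inj₁ (ℕ.+-mono-<-≤ lt i′≤1)
      go (inj₂ (refl , a≤a′)) (inj₂ refl) = inj₁ (ℕ.+-monoʳ-< A (s≤s z≤n))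
      go (inj₂ (refl , a≤a′)) (inj₁ lt) with ℕ.m≤n⇒m<n∨m≡n i′≤1
      ... | inj₁ i′<1 = inj₁ (ℕ.+-monoʳ-< A i′<1)
      ... | inj₂ refl = inj₂ (refl , E-least k a c′
              (ℕ.≤-<-trans (ℕ.*-monoˡ-≤ (s (suc k)) a≤a′) lt))
    ... | no c≮t = go H up
      where
      weaken : ∀ {x} → x ≤ A → x < A ℕ.+ i ⊎ (x ≡ A ℕ.+ i × 0 ≤ c′)
      weaken x≤A with ℕ.m≤n⇒m<n∨m≡n (ℕ.≤-trans x≤A (ℕ.m≤m+n A i))
      ... | inj₁ lt = inj₁ lt
      ... | inj₂ eq = inj₂ (eq , z≤n)
      go : A′ < A ⊎ (A′ ≡ A × a ≤ a′) → (a′ ℕ.* s (suc k) < c′ ℕ.* s k ⊎ i′ ≡ 0) →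
           A′ ℕ.+ i′ < A ℕ.+ i ⊎ (A′ ℕ.+ i′ ≡ A ℕ.+ i × 0 ≤ c′)
      go (inj₁ lt) _ = weaken (ℕ.≤-trans (ℕ.+-monoʳ-≤ A′ i′≤1) (subst (_≤ A) (ℕ.+-comm 1 A′) lt))
      go (inj₂ (refl , a≤a′)) (inj₂ refl) = weaken (ℕ.≤-reflexive (ℕ.+-identityʳ A))
      go (inj₂ (refl , a≤a′)) (inj₁ lt) = contradiction
        (ℕ.≤-<-trans (E-least k a c′ (ℕ.≤-<-trans (ℕ.*-monoˡ-≤ (s (suc k)) a≤a′) lt)) c′<t) c≮t

    ind-up : ∀ {P R : Set} (P? : Dec P) → (P → R) → R ⊎ ind P? ≡ 0
    ind-up (yes p) f = inj₁ (f p)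
    ind-up (no _)  _ = inj₂ refl

    Ê : ∀ m → Vector ℕ (suc m)
    Ê m i = E (toℕ i)

    last-Ê : ∀ m → last (Ê m) ≡ E m
    last-Ê m = cong E (Fin.toℕ-fromℕ m)

    init-Ê : ∀ m → init (Ê (suc m)) ≗ Ê m
    init-Ê m i = cong E (Fin.toℕ-inject₁ i)

    best : ∀ m → Best (Ê m)
    best zero f f∈ with 1 ℕ.<? s 0
    ... | yes 1<s with f zero in eq
    ...   | zero  = inj₁ (s≤s z≤n)
    ...   | suc k = inj₂ (refl , s≤s z≤n)
    best zero f f∈ | no 1≮s with f zero in eq
    ...   | zero  = inj₂ (refl , z≤n)
    ...   | suc k = contradiction
              (ℕ.≤-<-trans (subst (1 ≤_) (sym eq) (s≤s z≤n)) (f∈ zero)) 1≮s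
    best (suc m) f f∈ = subst₂ (λ x y → asc f < x ⊎ (asc f ≡ x × y ≤ last f)) (sym ascÊ) (sym (last-Ê (suc m)))
      (subst (λ x → x < asc (Ê m) ℕ.+ i ⊎ (x ≡ asc (Ê m) ℕ.+ i × E (suc m) ≤ last f)) (sym (asc-init f))
        (step-lemma m {a = E m} {last (init f)} {last f} {i}
          (subst (λ k → last f < s k) (Fin.toℕ-fromℕ (suc m)) (f∈ (fromℕ (suc m))))
          (subst (λ y → asc (init f) < asc (Ê m) ⊎ (asc (init f) ≡ asc (Ê m) × y ≤ last (init f)))
            (last-Ê m) (best m (init f) (inv-init f∈)))
          (ind≤1 (ascent? f (fromℕ (suc m))))
          (ind-up (ascent? f (fromℕ (suc m))) (Equivalence.to (last-asc f)))
          (λ lt → ind-yes (ascent? (Ê (suc m)) (fromℕ (suc m))) (Equivalence.from (last-asc (Ê (suc m)))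
            (subst₂ (λ x y → x ℕ.* s (suc m) < y ℕ.* s m)
              (sym (trans (init-Ê m (fromℕ m)) (last-Ê m))) (sym (last-Ê (suc m))) lt)))))
      where
      i = ind (ascent? (Ê (suc m)) (fromℕ (suc m)))
      ascÊ : asc (Ê (suc m)) ≡ asc (Ê m) ℕ.+ i
      ascÊ = trans (asc-init (Ê (suc m))) (cong (ℕ._+ i) (asc-cong (init-Ê m)))

    -- Best e means that e maximises s asc - last.
    objective : ∀ t A A′ a a′ → a < t → A′ < A ⊎ (A′ ≡ A × a ≤ a′) →
                + t ℤ.* + A′ ℤ.- + a′ ℤ.≤ + t ℤ.* + A ℤ.- + a
    objective t A .A a a′ a<t (inj₂ (refl , a≤a′)) =
      ℤ.+-monoʳ-≤ (+ t ℤ.* + A) (ℤ.neg-mono-≤ (ℤ.+≤+ a≤a′))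
    objective t A A′ a a′ a<t (inj₁ lt) = begin
      + t ℤ.* + A′ ℤ.- + a′        ≤⟨ ℤ.i≤j⇒i-k≤j (+ a′) ℤ.≤-refl ⟩
      + t ℤ.* + A′                 ≡⟨ ℤ.pos-* t A′ ⟨
      + (t ℕ.* A′)                 ≤⟨ ℤ.+≤+ (ℕ.m≤n+m (t ℕ.* A′) (t ℕ.∸ a)) ⟩
      + (t ℕ.∸ a ℕ.+ t ℕ.* A′)     ≡⟨ cong +_ (ℕ.+-∸-comm (t ℕ.* A′) (ℕ.<⇒≤ a<t)) ⟨
      + (t ℕ.+ t ℕ.* A′ ℕ.∸ a)     ≡⟨ cong (λ x → + (x ℕ.∸ a)) (ℕ.*-suc t A′) ⟨
      + (t ℕ.* suc A′ ℕ.∸ a)       ≤⟨ ℤ.+≤+ (ℕ.∸-monoˡ-≤ a (ℕ.*-monoʳ-≤ t lt)) ⟩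
      + (t ℕ.* A ℕ.∸ a)            ≡⟨ ℤ.⊖-≥ a≤tA ⟨
      t ℕ.* A ℤ.⊖ a                ≡⟨ ℤ.m-n≡m⊖n (t ℕ.* A) a ⟨
      + (t ℕ.* A) ℤ.- + a          ≡⟨ cong (ℤ._- + a) (ℤ.pos-* t A) ⟩
      + t ℤ.* + A ℤ.- + a          ∎
      where
      open ℤ.≤-Reasoning
      a≤tA : a ≤ t ℕ.* A
      a≤tA = ℕ.≤-trans (ℕ.<⇒≤ a<t) (ℕ.m≤m*n t A {{ℕ.>-nonZero (ℕ.≤-<-trans z≤n lt)}})

  isStar-exists : ∀ m → ∃ (IsStar {m})
  isStar-exists m = Ê m , record
    { inv      = λ i → E<s (toℕ i)
    ; asc-max  = λ f f∈ → asc≤ f (best m f f∈)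
    ; last-min = λ f f∈ eq → last≤ f eq (best m f f∈)
    ; prefix   = λ j j<m f f∈ →
        let eq : Ê j ≗ (λ i → Ê m (inject≤ i (s≤s (ℕ.<⇒≤ j<m))))
            eq i = cong E (sym (Fin.toℕ-inject≤ i (s≤s (ℕ.<⇒≤ j<m))))
        in subst₂ (λ A a → + s j ℤ.* + asc f ℤ.- + last f ℤ.≤ + s j ℤ.* + A ℤ.- + a)
             (asc-cong eq) (eq (fromℕ j))
             (objective (s j) (asc (Ê j)) (asc f) (last (Ê j)) (last f)
               (subst (_< s j) (sym (last-Ê j)) (E<s j)) (best j f f∈))
    }
    where
    asc≤ : ∀ f → Better (Ê m) f → asc f ≤ asc (Ê m)
    asc≤ f (inj₁ lt)       = ℕ.<⇒≤ lt
    asc≤ f (inj₂ (eq , _)) = ℕ.≤-reflexive eq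
    last≤ : ∀ f → asc f ≡ asc (Ê m) → Better (Ê m) f → last (Ê m) ≤ last f
    last≤ f eq (inj₁ lt)       = contradiction eq (ℕ.<⇒≢ lt)
    last≤ f eq (inj₂ (_ , le)) = le

{-# OPTIONS --safe #-}
module Submission where

-- Let f_n(k) and g_n(k) be the numbers of lattice points with last coordinate k
-- in the cone 0 ≤ λ₁/s₁ ≤ … ≤ λₙ/sₙ and in its interior. As formal power series
-- Q_n = (1 - x^{s_n})^n f_n, and x^{n s_n} Q_n(1/x) = (1 - x^{s_n})^n g_n, so Q_n
-- is palindromic iff f_n(k) = g_n(k + C) for some C, and then C is the least
-- degree c_n of an interior point. With F and G the partial sums of f_{n-1} and
-- g_{n-1} and r = s_n/s_{n-1} = p/q,
--   f_n(k) = F(⌊k/r⌋),  g_n(k) = G(⌈k/r⌉ - 1),  c_n = ⌊c_{n-1} r⌋ + 1.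
-- If f_{n-1}(k) = g_{n-1}(k + c_{n-1}) and q x = p c_{n-1} + 1, the recursion gives
-- f_n(k) = g_n(k + x). Conversely f_{n-1}(k) ≤ g_{n-1}(k + c_{n-1}) always holds, so
-- f_n(k) = g_n(k + c_n) squeezes
--   F(⌊k/r⌋) ≤ G(⌊k/r⌋ + c_{n-1}) ≤ G(⌈(k + c_n)/r⌉ - 1)
-- to equalities: arbitrarily large k give f_{n-1} = g_{n-1}(· + c_{n-1}), and, G being
-- strictly increasing, k with k q ≡ -1 mod p gives q c_n = p c_{n-1} + 1.
-- Finally n s_n - c_n is the maximum of s_n asc e - e_n, whence c_n ≡ e*_n mod s_n.

open import Defs
open import Algebra.Bundles using (CommutativeRing)
open import Data.Bool using (if_then_else_)
open import Data.Fin using (fromℕ; inject₁)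
open import Data.Fin as Fin using (Fin; zero; suc; toℕ; inject≤)
import Data.Fin.Properties as Fin
open import Data.Fin.Relation.Unary.Top using (view; ‵fromℕ; ‵inject₁)
open import Data.Integer using (+_; _*_; -1ℤ)
open import Data.Integer as ℤ using (ℤ; -[1+_]; _+_; _-_; -_; _≤_; _<_; 0ℤ; 1ℤ; _/ℕ_)
open import Data.Integer.DivMod using ([n/ℕd]*d≤n; n<s[n/ℕd]*d)
import Data.Integer.Properties as ℤ
open import Data.Integer.Tactic.RingSolver using (solve-∀)
open import Data.List using (List; []; _∷_; length; filter; map; tabulate)
import Data.List.Properties as List
open import Data.List.Membership.Propositional using (_∈_)
open import Data.List.Membership.Propositional.Properties using (∈-map⁺; ∈-map⁻; ∈-filter⁺; ∈-filter⁻)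
open import Data.List.Membership.Propositional.Properties.WithK using (unique∧set⇒bag)
open import Data.List.Relation.Binary.BagAndSetEquality using (∼bag⇒↭)
open import Data.List.Relation.Binary.Permutation.Propositional.Properties using (↭-length)
open import Data.List.Relation.Unary.Unique.Propositional using (Unique)
import Data.List.Relation.Unary.Unique.Propositional.Properties as Unique
open import Data.Nat using (ℕ; suc; NonZero)
open import Data.Nat as ℕ using (zero)
open import Data.Nat.Coprimality using (Coprime)
open import Data.Nat.Coprimality as Coprime using (coprime-Bézout; coprime-divisor)
import Data.Nat.DivMod as ℕ
import Data.Nat.Divisibility as ℕ
import Data.Nat.GCD as ℕ
import Data.Nat.Properties as ℕ
open import Data.Nat.Tactic.RingSolver using () renaming (solve-∀ to ℕ-solve-∀)
open import Data.Product using (_×_)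
open import Data.Product using (_,_; ∃-syntax; proj₁; proj₂)
open import Data.Rational using (_/_)
open import Data.Rational as ℚ using (ℚ; 0ℚ; 1ℚ; toℚᵘ)
import Data.Rational.Properties as ℚ
open import Data.Rational.Solver using (module +-*-Solver)
open import Data.Rational.Unnormalised as ℚᵘ using (mkℚᵘ; *≡*; *≤*)
import Data.Rational.Unnormalised.Properties as ℚᵘ
open import Data.Vec using (Vec; []; _∷_; _∷ʳ_; lookup)
import Data.Vec as Vec
import Data.Vec.Properties as Vec
open import Data.Vec.Functional using (Vector)
open import Data.Vec.Functional using (init; last)
open import Function using (_⇔_)
open import Function using (_∘_; mk⇔; Equivalence)
open import Relation.Binary.PropositionalEquality using (_≡_)
open import Relation.Binary.PropositionalEquality
  using (_≢_; refl; sym; trans; cong; cong₂; subst; subst₂; module ≡-Reasoning)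
open import Relation.Nullary using (¬_; Dec; yes; no; contradiction; _×-dec_)
open import Relation.Nullary.Decidable using (dec-true; dec-false)

open import Algebra.Properties.CommutativeMonoid.Sum ℚ.+-0-commutativeMonoid
  using (sum; sum-cong-≗; sum-init-last)
open import Algebra.Properties.Semiring.Sum (CommutativeRing.semiring ℚ.+-*-commutativeRing)
  using (*-distribʳ-sum)

-- Floor division of integers

<-suc : ∀ {a b} → a < b → a + 1ℤ ≤ b
<-suc {a} lt = subst (_≤ _) (ℤ.+-comm 1ℤ a) (ℤ.i<j⇒suc[i]≤j lt)

suc-< : ∀ {a b} → a + 1ℤ ≤ b → a < b
suc-< {a} le = ℤ.suc[i]≤j⇒i<j (subst (_≤ _) (ℤ.+-comm a 1ℤ) le)

≤-pred⇒< : ∀ {a b} → a ≤ b - 1ℤ → a < b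
≤-pred⇒< {a} {b} le = suc-< (subst (a + 1ℤ ≤_) (eq b) (ℤ.+-monoˡ-≤ 1ℤ le))
  where
  eq : ∀ b → b - 1ℤ + 1ℤ ≡ b
  eq = solve-∀

<⇒≤-pred : ∀ {a b} → a < b → a ≤ b - 1ℤ
<⇒≤-pred {a} {b} lt = subst (_≤ b - 1ℤ) (eq a) (ℤ.+-monoˡ-≤ -1ℤ (<-suc lt))
  where
  eq : ∀ a → a + 1ℤ - 1ℤ ≡ a
  eq = solve-∀

module _ (d : ℕ) .{{_ : NonZero d}} where

  -- This and `/-bound` form the Galois connection between multiplication by `d` and floor division;
  -- the facts below rest on it.
  /-greatest : ∀ {j z} → j * + d ≤ z → j ≤ z /ℕ d
  /-greatest {j} {z} le = ℤ.≮⇒≥ λ lt → ℤ.<-irrefl refl (begin-strict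
    z                          <⟨ n<s[n/ℕd]*d z d ⟩
    ℤ.suc (z /ℕ d) * + d       ≤⟨ ℤ.*-monoʳ-≤-nonNeg (+ d) (ℤ.i<j⇒suc[i]≤j lt) ⟩
    j * + d                    ≤⟨ le ⟩
    z                          ∎)
    where open ℤ.≤-Reasoning

  /-bound : ∀ {j z} → j ≤ z /ℕ d → j * + d ≤ z
  /-bound {j} {z} le = ℤ.≤-trans (ℤ.*-monoʳ-≤-nonNeg (+ d) le) ([n/ℕd]*d≤n z d)

  /-unique : ∀ {j z} → j * + d ≤ z → z < (j + 1ℤ) * + d → z /ℕ d ≡ j
  /-unique {j} {z} lo hi = ℤ.≤-antisym
    (ℤ.≮⇒≥ λ lt → ℤ.<⇒≱ hi (/-bound (<-suc lt)))
    (/-greatest lo)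

  /-lower : ∀ z → (z /ℕ d) * + d ≤ z
  /-lower z = /-bound ℤ.≤-refl

  /-upper : ∀ z → z < (z /ℕ d + 1ℤ) * + d
  /-upper z = ℤ.≰⇒> λ le → ℤ.<⇒≱ (suc-< ℤ.≤-refl) (/-greatest le)

  /-shift : ∀ z j → (z - j * + d) /ℕ d ≡ z /ℕ d - j
  /-shift z j = /-unique
    (subst (_≤ z - j * + d) (sym (ℤ.*-distribʳ-+ (+ d) (z /ℕ d) (- j)))
      (subst (λ y → (z /ℕ d) * + d + y ≤ z - j * + d) (ℤ.neg-distribˡ-* j (+ d))
        (ℤ.+-monoˡ-≤ (- (j * + d)) (/-lower z))))
    (subst (z - j * + d <_) (eq (z /ℕ d) j (+ d)) (ℤ.+-monoˡ-< (- (j * + d)) (/-upper z)))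
    where
    eq : ∀ a b d → (a + 1ℤ) * d - b * d ≡ (a - b + 1ℤ) * d
    eq = solve-∀

  -- ⌈z / d⌉ = ⌊(z - 1) / d⌋ + 1
  /-neg : ∀ z → (- z) /ℕ d ≡ - ((z - 1ℤ) /ℕ d) - 1ℤ
  /-neg z = /-unique
    (subst₂ _≤_ (eq₁ y (+ d)) (eq₂ z) (ℤ.neg-mono-≤ (<-suc (/-upper (z - 1ℤ)))))
    (subst (- z <_) (eq₄ y (+ d)) (ℤ.neg-mono-< (≤-pred⇒< (/-lower (z - 1ℤ)))))
    where
    y = (z - 1ℤ) /ℕ d
    eq₁ : ∀ y d → - ((y + 1ℤ) * d) ≡ (- y - 1ℤ) * d
    eq₁ = solve-∀
    eq₂ : ∀ z → - (z - 1ℤ + 1ℤ) ≡ - z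
    eq₂ = solve-∀
    eq₄ : ∀ y d → - (y * d) ≡ (- y - 1ℤ + 1ℤ) * d
    eq₄ = solve-∀

-- Differences and partial sums

i≤∣i∣ : ∀ i → i ≤ + ℤ.∣ i ∣
i≤∣i∣ (+ n)    = ℤ.≤-refl
i≤∣i∣ -[1+ n ] = ℤ.-≤+

-- multiplication of the generating function by (1 - xˢ)ⁿ
Δ : ℕ → ℕ → (ℤ → ℤ) → ℤ → ℤ
Δ s zero    a = a
Δ s (suc n) a = Δ s n (λ k → a k - a (k - + s))

-- A substitution that turns steps of `t` into steps of `s` intertwines the two operators. Both the
-- floor maps and plain translations have this form.
Δ-∘ : ∀ {s t} n {φ : ℤ → ℤ} {a b} → (∀ k → φ (k - + t) ≡ φ k - + s) →
      (∀ k → b k ≡ a (φ k)) → ∀ k → Δ t n b k ≡ Δ s n a (φ k)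
Δ-∘ zero              φ-shift b≗a∘φ k = b≗a∘φ k
Δ-∘ {s} {t} (suc n) {a = a} φ-shift b≗a∘φ k = Δ-∘ n φ-shift
  (λ k → cong₂ _-_ (b≗a∘φ k) (trans (b≗a∘φ (k - + t)) (cong a (φ-shift k)))) k

-- `Δ` is linear and commutes with translation, hence with differences of any step `r`. Step 1
-- relates a function to its partial sums; step `s` raises the exponent `n`.
Δ-shift : ∀ s n r {a b} → (∀ k → b k ≡ a k - a (k - r)) →
          ∀ k → Δ s n b k ≡ Δ s n a k - Δ s n a (k - r)
Δ-shift s zero    r eq k = eq k
Δ-shift s (suc n) r {a} {b} eq k = Δ-shift s n r (λ k → begin
  b k - b (k - + s)
    ≡⟨ cong₂ _-_ (eq k) (eq (k - + s)) ⟩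
  (a k - a (k - r)) - (a (k - + s) - a (k - + s - r))
    ≡⟨ cong (λ j → (a k - a (k - r)) - (a (k - + s) - a j)) (swap k (+ s) r) ⟩
  (a k - a (k - r)) - (a (k - + s) - a (k - r - + s))
    ≡⟨ interchange (a k) (a (k - r)) (a (k - + s)) (a (k - r - + s)) ⟩
  (a k - a (k - + s)) - (a (k - r) - a (k - r - + s)) ∎) k
  where
  open ≡-Reasoning
  swap : ∀ k s r → k - s - r ≡ k - r - s
  swap = solve-∀
  interchange : ∀ x y z w → (x - y) - (z - w) ≡ (x - z) - (y - w)
  interchange = solve-∀

-- Differences of step `s` kill periodic functions, so agreement below some `l` is assumed; it
-- starts an upward induction.
Δ-injective : ∀ s n .{{_ : NonZero s}} {a b} → (∀ k → Δ s n a k ≡ Δ s n b k) →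
              ∀ l → (∀ k → k < l → a k ≡ b k) → ∀ k → a k ≡ b k
Δ-injective s zero    eq l below k = eq k
Δ-injective s (suc n) {a} {b} eq l below k = go _ k bound
  where
  open ≡-Reasoning
  smaller : ∀ {k j} → k < j → k - + s < j
  smaller {k} lt = ℤ.≤-<-trans (ℤ.i-j≤i k (+ s)) lt
  Δ≗ : ∀ k → a k - a (k - + s) ≡ b k - b (k - + s)
  Δ≗ = Δ-injective s n eq l λ k lt → cong₂ _-_ (below k lt) (below (k - + s) (smaller lt))
  restore : ∀ x y → x ≡ x - y + y
  restore = solve-∀
  go : ∀ N k → k < l + + N → a k ≡ b k
  go zero    k lt = below k (subst (k <_) (ℤ.+-identityʳ l) lt)
  go (suc N) k lt = begin
    a k                                    ≡⟨ restore (a k) (a (k - + s)) ⟩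
    a k - a (k - + s) + a (k - + s)        ≡⟨ cong₂ _+_ (Δ≗ k) (go N (k - + s) lt′) ⟩
    b k - b (k - + s) + b (k - + s)        ≡⟨ restore (b k) (b (k - + s)) ⟨
    b k                                    ∎
    where
    pull : ∀ l N → l + (1ℤ + N) - 1ℤ ≡ l + N
    pull = solve-∀
    lt′ : k - + s < l + + N
    lt′ = ℤ.<-≤-trans (ℤ.+-monoˡ-< (- + s) lt)
      (subst (l + + suc N - + s ≤_) (pull l (+ N))
        (ℤ.+-monoʳ-≤ (l + + suc N) (ℤ.neg-mono-≤ (ℤ.+≤+ (ℕ.>-nonZero⁻¹ s)))))
  bound : k < l + + suc ℤ.∣ k - l ∣
  bound = suc-< (subst (_≤ l + + suc ℤ.∣ k - l ∣) (regroup k l)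
    (ℤ.+-monoʳ-≤ l (ℤ.+-monoʳ-≤ 1ℤ (i≤∣i∣ (k - l)))))
    where
    regroup : ∀ k l → l + (1ℤ + (k - l)) ≡ k + 1ℤ
    regroup = solve-∀

-- Two antidifferences of one function on ℤ differ by a constant, which cancels in every window.
window-cong : ∀ {a b : ℤ → ℤ} → (∀ k → a k - a (k - 1ℤ) ≡ b k - b (k - 1ℤ)) →
              ∀ s k → a k - a (k - + s) ≡ b k - b (k - + s)
window-cong {a} {b} eq zero    k rewrite ℤ.+-identityʳ k =
  trans (ℤ.i≡j⇒i-j≡0 {a k} refl) (sym (ℤ.i≡j⇒i-j≡0 {b k} refl))
window-cong {a} {b} eq (suc s) k = begin
  a k - a (k - + suc s)
    ≡⟨ cong (λ j → a k - a j) (eq₁ k (+ s)) ⟩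
  a k - a (k - 1ℤ - + s)
    ≡⟨ split (a k) (a (k - 1ℤ)) (a (k - 1ℤ - + s)) ⟩
  (a k - a (k - 1ℤ)) + (a (k - 1ℤ) - a (k - 1ℤ - + s))
    ≡⟨ cong₂ _+_ (eq k) (window-cong {a} {b} eq s (k - 1ℤ)) ⟩
  (b k - b (k - 1ℤ)) + (b (k - 1ℤ) - b (k - 1ℤ - + s))
    ≡⟨ split (b k) (b (k - 1ℤ)) (b (k - 1ℤ - + s)) ⟨
  b k - b (k - 1ℤ - + s)
    ≡⟨ cong (λ j → b k - b j) (eq₁ k (+ s)) ⟨
  b k - b (k - + suc s) ∎
  where
  open ≡-Reasoning
  eq₁ : ∀ k s → k - (1ℤ + s) ≡ k - 1ℤ - s
  eq₁ = solve-∀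
  split : ∀ x y z → x - z ≡ (x - y) + (y - z)
  split = solve-∀

-- Summation starts at 0, which gives the full partial sum for functions that vanish on the negative
-- integers.
cumulative : (ℤ → ℕ) → ℤ → ℕ
cumulative a (+ zero)  = a 0ℤ
cumulative a (+ suc n) = cumulative a (+ n) ℕ.+ a (+ suc n)
cumulative a -[1+ n ]  = 0

VanishesBelow : ℤ → (ℤ → ℕ) → Set
VanishesBelow l a = ∀ k → k < l → a k ≡ 0

cumulative-step : ∀ {a} → VanishesBelow 0ℤ a →
                  ∀ k → cumulative a k ≡ cumulative a (k - 1ℤ) ℕ.+ a k
cumulative-step vb (+ zero)  = refl
cumulative-step vb (+ suc n) = refl
cumulative-step vb -[1+ n ]  = sym (vb -[1+ n ] ℤ.-<+)

cumulative-Δ : ∀ {a} → VanishesBelow 0ℤ a →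
               ∀ k → + a k ≡ + cumulative a k - + cumulative a (k - 1ℤ)
cumulative-Δ {a} vb k = begin
  + a k                                ≡⟨ eq (+ cumulative a (k - 1ℤ)) (+ a k) ⟩
  + (cumulative a (k - 1ℤ) ℕ.+ a k) - + cumulative a (k - 1ℤ)
                                       ≡⟨ cong (λ x → + x - + cumulative a (k - 1ℤ)) (cumulative-step vb k) ⟨
  + cumulative a k - + cumulative a (k - 1ℤ) ∎
  where
  open ≡-Reasoning
  eq : ∀ x y → y ≡ (x + y) - x
  eq = solve-∀

from-below : ∀ {P : ℤ → Set} → (∀ k → k < 0ℤ → P k) → (∀ k → P (k - 1ℤ) → P k) → ∀ k → P k
from-below base step (+ zero)  = step 0ℤ (base -1ℤ ℤ.-<+)
from-below {P} base step (+ suc n) = step (+ suc n) (from-below {P} base step (+ n))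
from-below base step -[1+ n ]  = base -[1+ n ] ℤ.-<+

cumulative-vanishes : ∀ {a} l → VanishesBelow l a → VanishesBelow l (cumulative a)
cumulative-vanishes l vb (+ zero)  lt = vb 0ℤ lt
cumulative-vanishes l vb (+ suc n) lt =
  cong₂ ℕ._+_ (cumulative-vanishes l vb (+ n) (ℤ.<-trans (ℤ.+<+ ℕ.≤-refl) lt)) (vb (+ suc n) lt)
cumulative-vanishes l vb -[1+ n ]  lt = refl

cumulative-mono : ∀ {a} → VanishesBelow 0ℤ a → ∀ {j k} → j ≤ k → cumulative a j ℕ.≤ cumulative a k
cumulative-mono {a} vb {j} {k} j≤k = subst (λ x → cumulative a j ℕ.≤ cumulative a x) (eq₂ k j) 
  (subst (λ x → cumulative a j ℕ.≤ cumulative a (j + x)) (ℤ.0≤i⇒+∣i∣≡i (ℤ.i≤j⇒0≤j-i j≤k)) (grow ℤ.∣ k - j ∣))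
  where
  eq₁ : ∀ j n → j + (1ℤ + n) - 1ℤ ≡ j + n
  eq₁ = solve-∀
  eq₂ : ∀ k j → j + (k - j) ≡ k
  eq₂ = solve-∀
  grow : ∀ n → cumulative a j ℕ.≤ cumulative a (j + + n)
  grow zero    = ℕ.≤-reflexive (cong (cumulative a) (sym (ℤ.+-identityʳ j)))
  grow (suc n) = subst (cumulative a j ℕ.≤_) (sym (cumulative-step vb (j + + suc n)))
    (ℕ.≤-trans (subst (λ x → cumulative a j ℕ.≤ cumulative a x) (sym (eq₁ j (+ n))) (grow n)) (ℕ.m≤m+n _ _))

module _ {a b : ℤ → ℕ} (c : ℕ) (va : VanishesBelow 0ℤ a) (vb : VanishesBelow 0ℤ b) where

  private
    b-step : ∀ k → cumulative b (k + + c) ≡ cumulative b (k - 1ℤ + + c) ℕ.+ b (k + + c)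
    b-step k = trans (cumulative-step vb (k + + c))
      (cong (λ j → cumulative b j ℕ.+ b (k + + c)) (eq k (+ c)))
      where
      eq : ∀ k c → k + c - 1ℤ ≡ k - 1ℤ + c
      eq = solve-∀

    a-base : ∀ k → k < 0ℤ → cumulative a k ≡ 0
    a-base = cumulative-vanishes 0ℤ va

  cumulative-≤ : (∀ k → a k ℕ.≤ b (k + + c)) → ∀ k → cumulative a k ℕ.≤ cumulative b (k + + c)
  cumulative-≤ a≤b = from-below
    (λ k lt → subst (ℕ._≤ _) (sym (a-base k lt)) ℕ.z≤n)
    (λ k le → subst₂ ℕ._≤_ (sym (cumulative-step va k)) (sym (b-step k)) (ℕ.+-mono-≤ le (a≤b k)))

  -- `vb′` clears the terms of `b` before `c`, which have no partner in `a`.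
  cumulative-≡ : VanishesBelow (+ c) b → (∀ k → a k ≡ b (k + + c)) →
                 ∀ k → cumulative a k ≡ cumulative b (k + + c)
  cumulative-≡ vb′ a≡b = from-below
    (λ k lt → trans (a-base k lt) (sym (cumulative-vanishes (+ c) vb′ (k + + c)
      (subst (k + + c <_) (ℤ.+-identityˡ (+ c)) (ℤ.+-monoˡ-< (+ c) lt)))))
    (λ k eq → trans (cumulative-step va k) (trans (cong₂ ℕ._+_ eq (a≡b k)) (sym (b-step k))))

  -- Both the partial sums and the single terms are ordered by ≤, so equality of the longer sums
  -- passes to the shorter ones. It descends from `k + N` to `k`, where it forces equality of the
  -- last terms.
  cumulative-≡⇒≡ : (∀ k → a k ℕ.≤ b (k + + c)) →
                   ∀ N k → cumulative a (k + + N) ≡ cumulative b (k + + N + + c) → a k ≡ b (k + + c)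
  cumulative-≡⇒≡ a≤b zero k eq rewrite ℤ.+-identityʳ k = ℕ.≤-antisym (a≤b k)
    (ℕ.+-cancelˡ-≤ (cumulative b (k - 1ℤ + + c)) _ _ (begin
      cumulative b (k - 1ℤ + + c) ℕ.+ b (k + + c) ≡⟨ b-step k ⟨
      cumulative b (k + + c)                      ≡⟨ eq ⟨
      cumulative a k                              ≡⟨ cumulative-step va k ⟩
      cumulative a (k - 1ℤ) ℕ.+ a k               ≤⟨ ℕ.+-monoˡ-≤ (a k) (cumulative-≤ a≤b (k - 1ℤ)) ⟩
      cumulative b (k - 1ℤ + + c) ℕ.+ a k         ∎))
    where open ℕ.≤-Reasoning
  cumulative-≡⇒≡ a≤b (suc N) k eq = cumulative-≡⇒≡ a≤b N k
    (ℕ.≤-antisym (cumulative-≤ a≤b j) (ℕ.+-cancelʳ-≤ (b (j + 1ℤ + + c)) _ _ (begin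
      cumulative b (j + + c) ℕ.+ b (j + 1ℤ + + c)
        ≡⟨ cong (λ x → cumulative b (x + + c) ℕ.+ b (j + 1ℤ + + c)) (eq₁ j) ⟩
      cumulative b (j + 1ℤ - 1ℤ + + c) ℕ.+ b (j + 1ℤ + + c)
        ≡⟨ b-step (j + 1ℤ) ⟨
      cumulative b (j + 1ℤ + + c)
        ≡⟨ cong (λ x → cumulative b (x + + c)) (eq₂ k (+ N)) ⟩
      cumulative b (k + + suc N + + c)
        ≡⟨ eq ⟨
      cumulative a (k + + suc N)
        ≡⟨ cong (cumulative a) (eq₂ k (+ N)) ⟨
      cumulative a (j + 1ℤ)
        ≡⟨ cumulative-step va (j + 1ℤ) ⟩
      cumulative a (j + 1ℤ - 1ℤ) ℕ.+ a (j + 1ℤ)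
        ≡⟨ cong (λ x → cumulative a x ℕ.+ a (j + 1ℤ)) (eq₁ j) ⟨
      cumulative a j ℕ.+ a (j + 1ℤ)
        ≤⟨ ℕ.+-monoʳ-≤ (cumulative a j) (a≤b (j + 1ℤ)) ⟩
      cumulative a j ℕ.+ b (j + 1ℤ + + c)
        ∎)))
    where
    open ℕ.≤-Reasoning
    j = k + + N
    eq₁ : ∀ j → j ≡ j + 1ℤ - 1ℤ
    eq₁ = solve-∀
    eq₂ : ∀ k N → k + N + 1ℤ ≡ k + (1ℤ + N)
    eq₂ = solve-∀

-- Counting functions of the lecture hall cone

-- The count for the empty vector, whose last coordinate is taken to be 0.
δ₀ : ℤ → ℕ
δ₀ (+ zero)  = 1
δ₀ (+ suc _) = 0
δ₀ -[1+ _ ]  = 0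

-- Multiplying `q * x ≡ p * c + 1ℤ` by `h` shows that `x` multiples of σ exceed `c` multiples of τ
-- by exactly `h`.
shifted-multiple : ∀ {σ τ} k h p q x c → σ ≡ h * q → τ ≡ h * p → q * x ≡ p * c + 1ℤ →
                   (k + x) * σ ≡ k * σ + h + c * τ
shifted-multiple k h p q x c refl refl qx = begin
  (k + x) * (h * q)                   ≡⟨ expand k h q x ⟩
  k * (h * q) + h * (q * x)           ≡⟨ cong (λ y → k * (h * q) + h * y) qx ⟩
  k * (h * q) + h * (p * c + 1ℤ)      ≡⟨ collect (k * (h * q)) h p c ⟩
  k * (h * q) + h + c * (h * p)       ∎
  where
  open ≡-Reasoning
  expand : ∀ k h q x → (k + x) * (h * q) ≡ k * (h * q) + h * (q * x)
  expand = solve-∀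
  collect : ∀ y h p c → y + h * (p * c + 1ℤ) ≡ y + h + c * (h * p)
  collect = solve-∀

-- both sides are multiples of h
multiples-gap : ∀ {σ τ} k y h p q → σ ≡ + h * q → τ ≡ + h * p → k * σ < y * τ → k * σ + + h ≤ y * τ
multiples-gap k y h p q refl refl lt = begin
  k * (+ h * q) + + h   ≡⟨ factor k (+ h) q ⟩
  + h * (k * q + 1ℤ)    ≤⟨ ℤ.*-monoˡ-≤-nonNeg (+ h) (<-suc (ℤ.*-cancelˡ-<-nonNeg (+ h)
                             (subst₂ _<_ (swap k (+ h) q) (swap y (+ h) p) lt))) ⟩
  + h * (y * p)         ≡⟨ swap y (+ h) p ⟨
  y * (+ h * p)         ∎
  where
  open ℤ.≤-Reasoning
  swap : ∀ k h q → k * (h * q) ≡ h * (k * q)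
  swap = solve-∀
  factor : ∀ k h q → k * (h * q) + h ≡ h * (k * q + 1ℤ)
  factor = solve-∀

-1-multiple : ∀ {p q} .{{_ : NonZero p}} → Coprime p q → ∃[ k ] ∃[ y ] k ℕ.* q ℕ.+ 1 ≡ y ℕ.* p
-1-multiple {p@(suc p′)} {q} co with coprime-Bézout co
... | ℕ.Bézout.+- x y eq = y , x , trans (ℕ.+-comm (y ℕ.* q) 1) eq
-- Here y q ≡ 1 mod p, and the factor p′ = p - 1 ≡ -1 changes the sign.
... | ℕ.Bézout.-+ x y eq = p′ ℕ.* y , 1 ℕ.+ p′ ℕ.* x , (begin
  p′ ℕ.* y ℕ.* q ℕ.+ 1           ≡⟨ cong (ℕ._+ 1) (ℕ.*-assoc p′ y q) ⟩
  p′ ℕ.* (y ℕ.* q) ℕ.+ 1         ≡⟨ cong (λ z → p′ ℕ.* z ℕ.+ 1) eq ⟨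
  p′ ℕ.* (1 ℕ.+ x ℕ.* p) ℕ.+ 1   ≡⟨ ring p′ x ⟩
  (1 ℕ.+ p′ ℕ.* x) ℕ.* p         ∎)
  where
  open ≡-Reasoning
  ring : ∀ p′ x → p′ ℕ.* (1 ℕ.+ x ℕ.* suc p′) ℕ.+ 1 ≡ (1 ℕ.+ p′ ℕ.* x) ℕ.* suc p′
  ring = ℕ-solve-∀

-- Modulo xˢ the factor (1 - xˢ)ⁿ is 1.
Δ-initial : ∀ s n {a} → (∀ k → k < 0ℤ → a k ≡ 0ℤ) → ∀ k → k < + s → Δ s n a k ≡ a k
Δ-initial s zero        va k lt = refl
Δ-initial s (suc n) {a} va k lt = begin
  Δ s n (λ k → a k - a (k - + s)) k   ≡⟨ Δ-initial s n va′ k lt ⟩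
  a k - a (k - + s)                   ≡⟨ cong (λ y → a k - y) (va (k - + s) k-s<0) ⟩
  a k - 0ℤ                            ≡⟨ ℤ.+-identityʳ (a k) ⟩
  a k                                 ∎
  where
  open ≡-Reasoning
  k-s<0 : k - + s < 0ℤ
  k-s<0 = subst (k - + s <_) (ℤ.+-inverseʳ (+ s)) (ℤ.+-monoˡ-< (- + s) lt)
  va′ : ∀ k → k < 0ℤ → a k - a (k - + s) ≡ 0ℤ
  va′ k k<0 = cong₂ _-_ (va k k<0) (va (k - + s) (ℤ.≤-<-trans (ℤ.i-j≤i k (+ s)) k<0))

-- On all of ℤ the range condition k ≤ d disappears, because `P` vanishes on both sides of [0, d].
-- Conversely `D` is the degree; it is nonnegative because `P` is nonzero at 0 and so at `D`.
Palindromic⇔symmetric : (P : ℤ → ℕ) → VanishesBelow 0ℤ P → P 0ℤ ≢ 0 →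
                        Palindromic (P ∘ +_) ⇔ (∃[ D ] ∀ k → P k ≡ P (D - k))
Palindromic⇔symmetric P vanishes P0≢0 = mk⇔ to from
  where
  a-a : ∀ D → D - D ≡ 0ℤ
  a-a = ℤ.+-inverseʳ
  to : Palindromic (P ∘ +_) → ∃[ D ] ∀ k → P k ≡ P (D - k)
  to (d , _ , above , _ , sym-d) = + d , symmetric
    where
    above′ : ∀ k → + d < k → P k ≡ 0
    above′ (+ k) (ℤ.+<+ lt) = above k lt
    symmetric : ∀ k → P k ≡ P (+ d - k)
    symmetric k@(-[1+ _ ]) = trans (vanishes k ℤ.-<+) (sym (above′ (+ d - k)
      (subst (_< + d - k) (ℤ.+-identityʳ (+ d)) (ℤ.+-monoʳ-< (+ d) (ℤ.neg-mono-< {k} {0ℤ} ℤ.-<+)))))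
    symmetric (+ k) with k ℕ.≤? d
    ... | yes k≤d = trans (sym-d k k≤d) (cong P (trans (sym (ℤ.⊖-≥ k≤d)) (sym (ℤ.m-n≡m⊖n d k))))
    ... | no  k≰d = trans (above k (ℕ.≰⇒> k≰d)) (sym (vanishes (+ d - + k)
      (subst (+ d - + k <_) (a-a (+ k)) (ℤ.+-monoˡ-< (- + k) (ℤ.+<+ (ℕ.≰⇒> k≰d))))))
  from : (∃[ D ] ∀ k → P k ≡ P (D - k)) → Palindromic (P ∘ +_)
  from (-[1+ d ] , symmetric) = contradiction (trans (symmetric 0ℤ) (vanishes (-[1+ d ] - 0ℤ) ℤ.-<+)) P0≢0
  from (+ d , symmetric) = d , ℕ.n≢0⇒n>0 (P0≢0 ∘ trans P0≡Pd) , above , P0≢0 ,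
    λ k k≤d → trans (symmetric (+ k)) (cong P (trans (ℤ.m-n≡m⊖n d k) (ℤ.⊖-≥ k≤d)))
    where
    P0≡Pd : P 0ℤ ≡ P (+ d)
    P0≡Pd = trans (symmetric 0ℤ) (cong P (ℤ.+-identityʳ (+ d)))
    above : ∀ k → d ℕ.< k → P (+ k) ≡ 0
    above k lt = trans (symmetric (+ k)) (vanishes (+ d - + k)
      (subst (+ d - + k <_) (a-a (+ k)) (ℤ.+-monoˡ-< (- + k) (ℤ.+<+ lt))))

module Counts (S : ℕ → ℕ) {{S≢0 : ∀ {n} → NonZero (S n)}} where

  -- With `S n` as sₙ, the largest l with l / sₙ ≤ k / sₙ₊₁ and the largest l with l / sₙ < k /
  -- sₙ₊₁: the bounds on the next-to-last coordinate.
  φ ψ : ℕ → ℤ → ℤ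
  φ n k = (k * + S n) /ℕ S (suc n)
  ψ n k = (k * + S n - 1ℤ) /ℕ S (suc n)

  -- the numbers of lattice points with last coordinate k in the cone
  -- 0 ≤ λ₁/s₁ ≤ … ≤ λₙ/sₙ and in its interior
  cone interior : ℕ → ℤ → ℕ
  cone     zero    k = δ₀ k
  cone     (suc n) k = cumulative (cone n) (φ n k)
  interior zero    k = δ₀ k
  interior (suc n) k = cumulative (interior n) (ψ n k)

  -- the least last coordinate of an interior lattice point
  least : ℕ → ℕ
  least zero    = 0
  least (suc n) = suc ((least n ℕ.* S (suc n)) ℕ./ S n)

  least-< : ∀ n → least n ℕ.* S (suc n) ℕ.< least (suc n) ℕ.* S n
  least-< n = begin-strict
    m                                ≡⟨ ℕ.m≡m%n+[m/n]*n m (S n) ⟩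
    m ℕ.% S n ℕ.+ m ℕ./ S n ℕ.* S n  <⟨ ℕ.+-monoˡ-< _ (ℕ.m%n<n m (S n)) ⟩
    least (suc n) ℕ.* S n            ∎
    where
    open ℕ.≤-Reasoning
    m = least n ℕ.* S (suc n)

  least-minimal : ∀ n x → least n ℕ.* S (suc n) ℕ.< x ℕ.* S n → least (suc n) ℕ.≤ x
  least-minimal n x lt = ℕ.m<n*o⇒m/o<n {o = S n} lt

  φ-nonNeg : ∀ n {k} → 0ℤ ≤ k → 0ℤ ≤ φ n k
  φ-nonNeg n 0≤k = /-greatest (S (suc n)) (ℤ.*-monoʳ-≤-nonNeg (+ S n) 0≤k)

  φ-neg : ∀ n {k} → k < 0ℤ → φ n k < 0ℤ
  φ-neg n {k} k<0 = ℤ.≰⇒> λ le → ℤ.<⇒≱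
    (ℤ.*-monoʳ-<-pos (+ S n) {{ℤ.positive (ℤ.+<+ (ℕ.>-nonZero⁻¹ (S n)))}} k<0)
    (/-bound (S (suc n)) le)

  ψ-below : ∀ n {k} → k < + least (suc n) → ψ n k < + least n
  ψ-below n {k} lt = ℤ.≰⇒> λ le → go k lt
    (≤-pred⇒< (subst (_≤ k * + S n - 1ℤ) (sym (ℤ.pos-* (least n) (S (suc n)))) (/-bound (S (suc n)) le)))
    where
    go : ∀ k → k < + least (suc n) → + (least n ℕ.* S (suc n)) < k * + S n → _
    go (+ x)      lt lt′ = ℤ.<⇒≱ lt (ℤ.+≤+ (least-minimal n x
      (ℤ.drop‿+<+ (subst (_ <_) (sym (ℤ.pos-* x (S n))) lt′))))
    go k@(-[1+ x ]) lt lt′ = ℤ.<⇒≱ (ℤ.≤-<-trans (ℤ.+≤+ ℕ.z≤n) lt′)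
      (ℤ.*-monoʳ-≤-nonNeg (+ S n) {k} {0ℤ} ℤ.-≤+)

  cone-vanishes : ∀ n → VanishesBelow 0ℤ (cone n)
  cone-vanishes zero    -[1+ _ ] _ = refl
  cone-vanishes zero    (+ n) (ℤ.+<+ ())
  cone-vanishes (suc n) k lt = cumulative-vanishes 0ℤ (cone-vanishes n) (φ n k) (φ-neg n lt)

  interior-vanishes : ∀ n → VanishesBelow (+ least n) (interior n)
  interior-vanishes zero    = cone-vanishes zero
  interior-vanishes (suc n) k lt =
    cumulative-vanishes (+ least n) (interior-vanishes n) (ψ n k) (ψ-below n lt)

  interior-vanishes₀ : ∀ n → VanishesBelow 0ℤ (interior n)
  interior-vanishes₀ n k lt = interior-vanishes n k (ℤ.<-≤-trans lt (ℤ.+≤+ ℕ.z≤n))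

  -- The inequality l / sₙ ≤ k / sₙ₊₁ added to the strict one between the least interior degrees is
  -- again strict, and `ψ` is the largest solution of the strict inequality.
  φ+least≤ψ : ∀ n k → φ n k + + least n ≤ ψ n (k + + least (suc n))
  φ+least≤ψ n k = /-greatest t (begin
    (φ n k + + least n) * + t                ≡⟨ ℤ.*-distribʳ-+ (+ t) (φ n k) (+ least n) ⟩
    φ n k * + t + + least n * + t            ≤⟨ ℤ.+-mono-≤ (/-lower t (k * + S n)) (<⇒≤-pred lt) ⟩
    k * + S n + (+ least (suc n) * + S n - 1ℤ) ≡⟨ eq k (+ least (suc n)) (+ S n) ⟩
    (k + + least (suc n)) * + S n - 1ℤ       ∎)
    where
    open ℤ.≤-Reasoning
    t = S (suc n)
    lt : + least n * + t < + least (suc n) * + S n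
    lt = subst₂ _<_ (ℤ.pos-* (least n) t) (ℤ.pos-* (least (suc n)) (S n)) (ℤ.+<+ (least-< n))
    eq : ∀ k x s → k * s + (x * s - 1ℤ) ≡ (k + x) * s - 1ℤ
    eq = solve-∀

  -- translation by an interior point with least last coordinate
  cone≤interior : ∀ n k → cone n k ℕ.≤ interior n (k + + least n)
  cone≤interior zero    k = ℕ.≤-reflexive (cong δ₀ (sym (ℤ.+-identityʳ k)))
  cone≤interior (suc n) k = ℕ.≤-trans
    (cumulative-≤ (least n) (cone-vanishes n) (interior-vanishes₀ n) (cone≤interior n) (φ n k))
    (cumulative-mono (interior-vanishes₀ n) (φ+least≤ψ n k))

  -- The point (0, ..., 0, k) is always available. Dimension 0 is left out, as `δ₀` vanishes at
  -- positive `k`.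
  cone-positive : ∀ n {k} → 0ℤ ≤ k → 0 ℕ.< cone (suc n) k
  cumulative-positive : ∀ n → 0 ℕ.< cumulative (cone n) 0ℤ

  cone-positive n 0≤k = ℕ.<-≤-trans (cumulative-positive n)
    (cumulative-mono (cone-vanishes n) (φ-nonNeg n 0≤k))
  cumulative-positive zero    = ℕ.≤-refl
  cumulative-positive (suc n) = cone-positive n ℤ.≤-refl

  interior-positive : ∀ n {k} → + least (suc n) ≤ k → 0 ℕ.< interior (suc n) k
  interior-positive n {k} le = subst (λ x → 0 ℕ.< interior (suc n) x) (eq k c)
    (ℕ.<-≤-trans (cone-positive n (ℤ.i≤j⇒0≤j-i le)) (cone≤interior (suc n) (k - c)))
    where
    c = + least (suc n)
    eq : ∀ k c → k - c + c ≡ k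
    eq = solve-∀

  -- palindromicity of the n-th polynomial, with C = n sₙ - deg; in Stanley's
  -- criterion, that the cone is Gorenstein
  Gorenstein : ℕ → Set
  Gorenstein n = ∃[ C ] (∀ k → cone n k ≡ interior n (k + C))

  -- The supports of the two counts begin at 0 and at `least (suc n)`, and the translation has to
  -- match these starting points.
  shift-unique : ∀ n C → (∀ k → cone (suc n) k ≡ interior (suc n) (k + C)) → C ≡ + least (suc n)
  shift-unique n C eq = ℤ.≤-antisym
    (ℤ.≮⇒≥ λ lt → ℕ.<⇒≢ (interior-positive n ℤ.≤-refl) (begin
      0                            ≡⟨ cone-vanishes (suc n) (c - C) (subst (c - C <_) (ℤ.+-inverseʳ C) (ℤ.+-monoˡ-< (- C) lt)) ⟨
      cone (suc n) (c - C)         ≡⟨ eq (c - C) ⟩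
      interior (suc n) (c - C + C) ≡⟨ cong (interior (suc n)) (cancel c C) ⟩
      interior (suc n) c           ∎))
    (ℤ.≮⇒≥ λ lt → ℕ.<⇒≢ (cone-positive n ℤ.≤-refl) (begin
      0                         ≡⟨ interior-vanishes (suc n) (0ℤ + C) (subst (_< c) (sym (ℤ.+-identityˡ C)) lt) ⟨
      interior (suc n) (0ℤ + C) ≡⟨ eq 0ℤ ⟨
      cone (suc n) 0ℤ           ∎))
    where
    open ≡-Reasoning
    c = + least (suc n)
    cancel : ∀ c C → c - C + C ≡ c
    cancel = solve-∀

  -- Descent of the Gorenstein property to the previous dimension

  module _ n (G : ∀ k → cone (suc n) k ≡ interior (suc n) (k + + least (suc n))) where

    -- Both sides lie between `cone (suc n) k` and `interior (suc n) (k + + least (suc n))`, which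
    -- `G` makes equal.
    cumulative-cone≡interior : ∀ k → cumulative (cone n) (φ n k) ≡ cumulative (interior n) (φ n k + + least n)
    cumulative-cone≡interior k = ℕ.≤-antisym
      (cumulative-≤ (least n) (cone-vanishes n) (interior-vanishes₀ n) (cone≤interior n) (φ n k))
      (ℕ.≤-trans (cumulative-mono (interior-vanishes₀ n) (φ+least≤ψ n k)) (ℕ.≤-reflexive (sym (G k))))

    Gorenstein-pred : ∀ k → cone n k ≡ interior n (k + + least n)
    Gorenstein-pred k@(-[1+ _ ]) = trans (cone-vanishes n k ℤ.-<+)
      (sym (interior-vanishes n (k + + least n)
        (subst (k + + least n <_) (ℤ.+-identityˡ _) (ℤ.+-monoˡ-< (+ least n) {k} {0ℤ} ℤ.-<+))))
    Gorenstein-pred (+ i) = cumulative-≡⇒≡ (least n) (cone-vanishes n) (interior-vanishes₀ n)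
      (cone≤interior n) ℤ.∣ φ n k - + i ∣ (+ i)
      (subst (λ x → cumulative (cone n) x ≡ cumulative (interior n) (x + + least n)) eq
        (cumulative-cone≡interior k))
      where
      t = S (suc n)
      -- At this `k` the value `φ n k` is `i` times `S n`, hence at least `i`, and the equality of
      -- partial sums there descends to `i`.
      k = + (i ℕ.* t)
      i≤φ : + i ≤ φ n k
      i≤φ = /-greatest t (subst₂ _≤_ (ℤ.pos-* i t) (ℤ.pos-* (i ℕ.* t) (S n)) (ℤ.+≤+ (ℕ.m≤m*n (i ℕ.* t) (S n))))
      cancel : ∀ x y → x ≡ y + (x - y)
      cancel = solve-∀
      eq : φ n k ≡ + i + + ℤ.∣ φ n k - + i ∣
      eq = trans (cancel (φ n k) (+ i)) (cong (λ x → + i + x) (sym (ℤ.0≤i⇒+∣i∣≡i (ℤ.i≤j⇒0≤j-i i≤φ))))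

  -- From `least (suc n)` on every interior count is positive, so the partial sums of
  -- `interior (suc n)` increase strictly. A larger `ψ` would break the equality forced by `G`;
  -- `0ℤ ≤ k` puts the index in that range.
  ψ≤φ+least : ∀ n → (∀ k → cone (suc (suc n)) k ≡ interior (suc (suc n)) (k + + least (suc (suc n)))) →
              ∀ {k} → 0ℤ ≤ k → ψ (suc n) (k + + least (suc (suc n))) ≤ φ (suc n) k + + least (suc n)
  ψ≤φ+least n G {k} 0≤k = ℤ.≮⇒≥ λ lt → ℕ.<-irrefl refl (begin-strict
    cumulative I j                     <⟨ ℕ.m<m+n _ (interior-positive n c≤) ⟩
    cumulative I j ℕ.+ I (j + 1ℤ)      ≡⟨ cong (λ x → cumulative I x ℕ.+ I (j + 1ℤ)) (eq j) ⟩
    cumulative I (j + 1ℤ - 1ℤ) ℕ.+ I (j + 1ℤ) ≡⟨ cumulative-step (interior-vanishes₀ (suc n)) (j + 1ℤ) ⟨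
    cumulative I (j + 1ℤ)              ≤⟨ cumulative-mono (interior-vanishes₀ (suc n)) (<-suc lt) ⟩
    cumulative I (ψ (suc n) (k + + least (suc (suc n)))) ≡⟨ G k ⟨
    cumulative (cone (suc n)) (φ (suc n) k)              ≡⟨ cumulative-cone≡interior (suc n) G k ⟩
    cumulative I j                     ∎)
    where
    open ℕ.≤-Reasoning
    I = interior (suc n)
    j = φ (suc n) k + + least (suc n)
    eq : ∀ j → j ≡ j + 1ℤ - 1ℤ
    eq = solve-∀
    c≤ : + least (suc n) ≤ j + 1ℤ
    c≤ = ℤ.≤-trans (subst (_≤ j) (ℤ.+-identityˡ _) (ℤ.+-monoˡ-≤ (+ least (suc n)) (φ-nonNeg (suc n) 0≤k)))
           (ℤ.i≤i+j j 1ℤ)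

  module _ n {h p q : ℕ} .{{_ : NonZero h}} (Sₙ : S n ≡ h ℕ.* q) (Sₙ₊₁ : S (suc n) ≡ h ℕ.* p) where

    -- The condition on `x` makes ψ(k + x) = φ(k) + c for all k, where c is the least degree. Indeed
    -- (k + x) sₙ = k sₙ + h + c sₙ₊₁, and since k sₙ and sₙ₊₁ are multiples of `h`, adding `h` to k
    -- sₙ does not pass the next larger multiple of sₙ₊₁.
    Gorenstein-suc : ∀ x → q ℕ.* x ≡ p ℕ.* least n ℕ.+ 1 →
                     (∀ k → cone n k ≡ interior n (k + + least n)) →
                     ∀ k → cone (suc n) k ≡ interior (suc n) (k + + x)
    Gorenstein-suc x qx G k = trans
      (cumulative-≡ (least n) (cone-vanishes n) (interior-vanishes₀ n) (interior-vanishes n) G (φ n k))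
      (cong (cumulative (interior n)) (sym ψ≡))
      where
      open ℤ.≤-Reasoning
      c = + least n
      t = S (suc n)
      s′ : + S n ≡ + h * + q
      s′ = trans (cong +_ Sₙ) (ℤ.pos-* h q)
      t′ : + t ≡ + h * + p
      t′ = trans (cong +_ Sₙ₊₁) (ℤ.pos-* h p)
      qx′ : + q * + x ≡ + p * c + 1ℤ
      qx′ = trans (sym (ℤ.pos-* q x)) (trans (cong +_ qx) (cong (_+ 1ℤ) (ℤ.pos-* p (least n))))
      xS : (k + + x) * + S n ≡ k * + S n + + h + c * + t
      xS = shifted-multiple k (+ h) (+ p) (+ q) (+ x) c s′ t′ qx′
      h≥1 : 1ℤ ≤ + h
      h≥1 = ℤ.+≤+ (ℕ.>-nonZero⁻¹ h)
      cancel : ∀ y w → y + 1ℤ + w - 1ℤ ≡ y + w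
      cancel = solve-∀
      kS+h≤ : k * + S n + + h ≤ (φ n k + 1ℤ) * + t
      kS+h≤ = multiples-gap k (φ n k + 1ℤ) h (+ p) (+ q) s′ t′ (/-upper t (k * + S n))
      ψ≡ : ψ n (k + + x) ≡ φ n k + c
      ψ≡ = /-unique t
        (begin
          (φ n k + c) * + t                  ≡⟨ ℤ.*-distribʳ-+ (+ t) (φ n k) c ⟩
          φ n k * + t + c * + t              ≤⟨ ℤ.+-monoˡ-≤ (c * + t) (/-lower t (k * + S n)) ⟩
          k * + S n + c * + t                ≡⟨ cancel (k * + S n) (c * + t) ⟨
          k * + S n + 1ℤ + c * + t - 1ℤ      ≤⟨ ℤ.+-monoˡ-≤ -1ℤ (ℤ.+-monoˡ-≤ (c * + t) (ℤ.+-monoʳ-≤ (k * + S n) h≥1)) ⟩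
          k * + S n + + h + c * + t - 1ℤ     ≡⟨ cong (_- 1ℤ) xS ⟨
          (k + + x) * + S n - 1ℤ             ∎)
        (≤-pred⇒< (begin
          (k + + x) * + S n - 1ℤ             ≡⟨ cong (_- 1ℤ) xS ⟩
          k * + S n + + h + c * + t - 1ℤ     ≤⟨ ℤ.+-monoˡ-≤ -1ℤ (ℤ.+-monoˡ-≤ (c * + t) kS+h≤) ⟩
          (φ n k + 1ℤ) * + t + c * + t - 1ℤ  ≡⟨ cong (_- 1ℤ) (factor (φ n k) c (+ t)) ⟩
          (φ n k + c + 1ℤ) * + t - 1ℤ        ∎))
        where
        factor : ∀ y c t → (y + 1ℤ) * t + c * t ≡ (y + c + 1ℤ) * t
        factor = solve-∀

  -- One inequality is the strict one satisfied by the least degrees. For the other, a `k` with k q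
  -- ≡ -1 mod p puts k s exactly `h` below a multiple y t, and there the bound on `ψ` is sharp
  -- enough.
  least-suc : ∀ n {h p q : ℕ} .{{_ : NonZero h}} .{{_ : NonZero p}} →
              S (suc n) ≡ h ℕ.* q → S (suc (suc n)) ≡ h ℕ.* p → Coprime p q →
              (∀ k → cone (suc (suc n)) k ≡ interior (suc (suc n)) (k + + least (suc (suc n)))) →
              q ℕ.* least (suc (suc n)) ≡ p ℕ.* least (suc n) ℕ.+ 1
  least-suc n {h} {p} {q} s≡ t≡ co G with k , y , kq≡ ← -1-multiple co =
    ℕ.≤-antisym upper (subst (ℕ._≤ q ℕ.* c′) (ℕ.+-comm 1 (p ℕ.* c)) lower)
    where
    s = S (suc n)
    t = S (suc (suc n))
    c = least (suc n)
    c′ = least (suc (suc n))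
    ks+h : k ℕ.* s ℕ.+ h ≡ y ℕ.* t
    ks+h = begin
      k ℕ.* s ℕ.+ h              ≡⟨ cong (λ x → k ℕ.* x ℕ.+ h) s≡ ⟩
      k ℕ.* (h ℕ.* q) ℕ.+ h      ≡⟨ ring₁ k h q ⟩
      h ℕ.* (k ℕ.* q ℕ.+ 1)      ≡⟨ cong (h ℕ.*_) kq≡ ⟩
      h ℕ.* (y ℕ.* p)            ≡⟨ ring₂ h y p ⟩
      y ℕ.* (h ℕ.* p)            ≡⟨ cong (y ℕ.*_) t≡ ⟨
      y ℕ.* t                    ∎
      where
      open ≡-Reasoning
      ring₁ : ∀ k h q → k ℕ.* (h ℕ.* q) ℕ.+ h ≡ h ℕ.* (k ℕ.* q ℕ.+ 1)
      ring₁ = ℕ-solve-∀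
      ring₂ : ∀ h y p → h ℕ.* (y ℕ.* p) ≡ y ℕ.* (h ℕ.* p)
      ring₂ = ℕ-solve-∀
    φ<y : φ (suc n) (+ k) < + y
    φ<y = ℤ.≰⇒> λ le → ℕ.<⇒≱ (subst (k ℕ.* s ℕ.<_) ks+h (ℕ.m<m+n (k ℕ.* s) (ℕ.>-nonZero⁻¹ h)))
      (ℤ.drop‿+≤+ (subst₂ _≤_ (sym (ℤ.pos-* y t)) (sym (ℤ.pos-* k s)) (/-bound t le)))
    ψ<y+c : ψ (suc n) (+ k + + c′) < + y + + c
    ψ<y+c = ℤ.≤-<-trans (ψ≤φ+least n G {+ k} (ℤ.+≤+ ℕ.z≤n)) (ℤ.+-monoˡ-< (+ c) φ<y)
    kc′s≤yct : (k ℕ.+ c′) ℕ.* s ℕ.≤ (y ℕ.+ c) ℕ.* t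
    kc′s≤yct = ℕ.≮⇒≥ λ lt → ℤ.<⇒≱ ψ<y+c (/-greatest t (<⇒≤-pred
      (subst₂ _<_ (ℤ.pos-* (y ℕ.+ c) t) (ℤ.pos-* (k ℕ.+ c′) s) (ℤ.+<+ lt))))
    upper : q ℕ.* c′ ℕ.≤ p ℕ.* c ℕ.+ 1
    upper = ℕ.*-cancelˡ-≤ h (ℕ.+-cancelˡ-≤ (k ℕ.* s) _ _ (begin
      k ℕ.* s ℕ.+ h ℕ.* (q ℕ.* c′)         ≡⟨ cong (k ℕ.* s ℕ.+_) (trans (ring₁ h q c′) (cong (c′ ℕ.*_) (sym s≡))) ⟩
      k ℕ.* s ℕ.+ c′ ℕ.* s                 ≡⟨ ℕ.*-distribʳ-+ s k c′ ⟨
      (k ℕ.+ c′) ℕ.* s                     ≤⟨ kc′s≤yct ⟩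
      (y ℕ.+ c) ℕ.* t                      ≡⟨ ℕ.*-distribʳ-+ t y c ⟩
      y ℕ.* t ℕ.+ c ℕ.* t                  ≡⟨ cong₂ ℕ._+_ (sym ks+h) (cong (c ℕ.*_) t≡) ⟩
      k ℕ.* s ℕ.+ h ℕ.+ c ℕ.* (h ℕ.* p)    ≡⟨ ring₂ (k ℕ.* s) h c p ⟩
      k ℕ.* s ℕ.+ h ℕ.* (p ℕ.* c ℕ.+ 1)    ∎))
      where
      open ℕ.≤-Reasoning
      ring₁ : ∀ h q c → h ℕ.* (q ℕ.* c) ≡ c ℕ.* (h ℕ.* q)
      ring₁ = ℕ-solve-∀
      ring₂ : ∀ x h c p → x ℕ.+ h ℕ.+ c ℕ.* (h ℕ.* p) ≡ x ℕ.+ h ℕ.* (p ℕ.* c ℕ.+ 1)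
      ring₂ = ℕ-solve-∀
    lower : suc (p ℕ.* c) ℕ.≤ q ℕ.* c′
    lower = ℕ.*-cancelˡ-< h _ _ (subst₂ ℕ._<_
      (trans (cong (c ℕ.*_) t≡) (ring c h p)) (trans (cong (c′ ℕ.*_) s≡) (ring c′ h q)) (least-< (suc n)))
      where
      ring : ∀ c h p → c ℕ.* (h ℕ.* p) ≡ h ℕ.* (p ℕ.* c)
      ring = ℕ-solve-∀

  -- Numerator polynomials and reciprocity

  φ-shift : ∀ n k → φ n (k - + S (suc n)) ≡ φ n k - + S n
  φ-shift n k = trans (cong (_/ℕ S (suc n)) (eq k (+ S n) (+ S (suc n)))) (/-shift (S (suc n)) (k * + S n) (+ S n))
    where
    eq : ∀ k s t → (k - t) * s ≡ k * s - s * t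
    eq = solve-∀

  ψ-shift : ∀ n k → ψ n (k - + S (suc n)) ≡ ψ n k - + S n
  ψ-shift n k = trans (cong (_/ℕ S (suc n)) (eq k (+ S n) (+ S (suc n)))) (/-shift (S (suc n)) (k * + S n - 1ℤ) (+ S n))
    where
    eq : ∀ k s t → (k - t) * s - 1ℤ ≡ k * s - 1ℤ - s * t
    eq = solve-∀

  -- Negation exchanges floor and ceiling, so reflecting the degree replaces `φ` by `ψ`. This is the
  -- source of the reciprocity between cone and interior.
  φ-reflect : ∀ n k → φ n (+ suc n * + S (suc n) - k) ≡ + suc n * + S n - 1ℤ - ψ n k
  φ-reflect n k = begin
    φ n (m * t - k)                          ≡⟨ cong (_/ℕ S (suc n)) (eq₁ m k s t) ⟩
    (- z) /ℕ S (suc n)                       ≡⟨ /-neg (S (suc n)) z ⟩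
    - ((z - 1ℤ) /ℕ S (suc n)) - 1ℤ           ≡⟨ cong (λ y → - (y /ℕ S (suc n)) - 1ℤ) (eq₂ k s (m * s * t)) ⟩
    - ((k * s - 1ℤ - m * s * t) /ℕ S (suc n)) - 1ℤ ≡⟨ cong (λ y → - y - 1ℤ) (/-shift (S (suc n)) (k * s - 1ℤ) (m * s)) ⟩
    - (ψ n k - m * s) - 1ℤ                   ≡⟨ eq₃ (ψ n k) (m * s) ⟩
    m * s - 1ℤ - ψ n k                       ∎
    where
    open ≡-Reasoning
    m = + suc n
    s = + S n
    t = + S (suc n)
    z = k * s - m * s * t
    eq₁ : ∀ m k s t → (m * t - k) * s ≡ - (k * s - m * s * t)
    eq₁ = solve-∀
    eq₂ : ∀ k s x → k * s - x - 1ℤ ≡ k * s - 1ℤ - x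
    eq₂ = solve-∀
    eq₃ : ∀ y x → - (y - x) - 1ℤ ≡ x - 1ℤ - y
    eq₃ = solve-∀

  -- P n k counts the lattice points of the n-th half-open parallelepiped with
  -- last coordinate k; the step is stated for an arbitrary antidifference N of
  -- P n, so that windows of P n are differences of N.
  module _ (P : ℕ → ℤ → ℕ) (P-zero : ∀ k → P 0 k ≡ δ₀ k)
           (P-suc : ∀ n (N : ℤ → ℤ) → (∀ k → + P n k ≡ N k - N (k - 1ℤ)) →
                    ∀ k → + P (suc n) k ≡ N (φ n k) - N (φ n k - + S n)) where

    private
      -- one step of the recursion, for a sequence R with θ in the role of φ
      numerator-suc : ∀ n {R R′ : ℤ → ℤ} θ {a} →
        (∀ (N : ℤ → ℤ) → (∀ k → R k ≡ N k - N (k - 1ℤ)) → ∀ k → R′ k ≡ N (θ k) - N (θ k - + S n)) →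
        (∀ k → θ (k - + S (suc n)) ≡ θ k - + S n) → VanishesBelow 0ℤ a →
        (∀ k → R k ≡ Δ (S n) n (+_ ∘ a) k) →
        ∀ k → R′ k ≡ Δ (S (suc n)) (suc n) (+_ ∘ cumulative a ∘ θ) k
      numerator-suc n {R} {R′} θ {a} R-suc θ-shift va R≡ k = begin
        R′ k                              ≡⟨ R-suc N (λ j → trans (R≡ j) (Δ-shift (S n) n 1ℤ {A} (cumulative-Δ va) j)) k ⟩
        N (θ k) - N (θ k - + S n)         ≡⟨ Δ-shift (S n) n (+ S n) {A} (λ _ → refl) (θ k) ⟨
        Δ (S n) (suc n) A (θ k)           ≡⟨ Δ-∘ (suc n) {θ} {A} θ-shift (λ _ → refl) k ⟨
        Δ (S (suc n)) (suc n) (A ∘ θ) k   ∎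
        where
        open ≡-Reasoning
        A = +_ ∘ cumulative a
        N = Δ (S n) n A

    P-cone : ∀ n k → + P n k ≡ Δ (S n) n (+_ ∘ cone n) k
    P-cone zero    k = cong +_ (P-zero k)
    P-cone (suc n) k = numerator-suc n (φ n) (P-suc n) (φ-shift n) (cone-vanishes n) (P-cone n) k

    -- The coefficients of x^{n sₙ} P(1/x).
    reflected : ℕ → ℤ → ℤ
    reflected n k = + P n (+ n * + S n - k)

    reflected-suc : ∀ n (N : ℤ → ℤ) → (∀ k → reflected n k ≡ N k - N (k - 1ℤ)) →
                    ∀ k → reflected (suc n) k ≡ N (ψ n k) - N (ψ n k - + S n)
    reflected-suc n N eq k = begin
      + P (suc n) (+ suc n * + S (suc n) - k)
        ≡⟨ P-suc n M M-eq (+ suc n * + S (suc n) - k) ⟩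
      M (φ n (+ suc n * + S (suc n) - k)) - M (φ n (+ suc n * + S (suc n) - k) - + S n)
        ≡⟨ cong (λ y → M y - M (y - + S n)) (φ-reflect n k) ⟩
      - N (x - 1ℤ - (+ suc n * + S n - 1ℤ - ψ n k)) - (- N (x - 1ℤ - (+ suc n * + S n - 1ℤ - ψ n k - + S n)))
        ≡⟨ cong₂ (λ y z → - N y - (- N z)) (eq₁ (+ n) (+ S n) (ψ n k)) (eq₂ (+ n) (+ S n) (ψ n k)) ⟩
      - N (ψ n k - + S n) - (- N (ψ n k))
        ≡⟨ eq₃ (N (ψ n k)) (N (ψ n k - + S n)) ⟩
      N (ψ n k) - N (ψ n k - + S n) ∎
      where
      open ≡-Reasoning
      x = + n * + S n
      M : ℤ → ℤ
      -- Reflection turns backward differences into forward ones; the sign and the shift by 1 make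
      -- `M` a backward antidifference of `P n`.
      M j = - N (x - 1ℤ - j)
      eq₁ : ∀ n s y → n * s - 1ℤ - ((1ℤ + n) * s - 1ℤ - y) ≡ y - s
      eq₁ = solve-∀
      eq₂ : ∀ n s y → n * s - 1ℤ - ((1ℤ + n) * s - 1ℤ - y - s) ≡ y
      eq₂ = solve-∀
      eq₃ : ∀ y z → - z - (- y) ≡ y - z
      eq₃ = solve-∀
      eq₄ : ∀ x j → j ≡ x - (x - j)
      eq₄ = solve-∀
      eq₅ : ∀ x j → x - j - 1ℤ ≡ x - 1ℤ - j
      eq₅ = solve-∀
      eq₆ : ∀ x j → x - j ≡ x - 1ℤ - (j - 1ℤ)
      eq₆ = solve-∀
      eq₇ : ∀ y z → y - z ≡ - z - (- y)
      eq₇ = solve-∀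
      M-eq : ∀ j → + P n j ≡ M j - M (j - 1ℤ)
      M-eq j = begin
        + P n j                                      ≡⟨ cong (+_ ∘ P n) (eq₄ x j) ⟩
        reflected n (x - j)                          ≡⟨ eq (x - j) ⟩
        N (x - j) - N (x - j - 1ℤ)                   ≡⟨ cong₂ (λ y z → N y - N z) (eq₆ x j) (eq₅ x j) ⟩
        N (x - 1ℤ - (j - 1ℤ)) - N (x - 1ℤ - j)       ≡⟨ eq₇ (N (x - 1ℤ - (j - 1ℤ))) (N (x - 1ℤ - j)) ⟩
        - N (x - 1ℤ - j) - (- N (x - 1ℤ - (j - 1ℤ))) ∎

    reflected-interior : ∀ n k → reflected n k ≡ Δ (S n) n (+_ ∘ interior n) k
    reflected-interior zero    k = cong +_ (trans (P-zero (0ℤ - k)) (even k))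
      where
      even : ∀ k → δ₀ (0ℤ - k) ≡ δ₀ k
      even (+ zero)  = refl
      even (+ suc _) = refl
      even -[1+ _ ]  = refl
    reflected-interior (suc n) k =
      numerator-suc n (ψ n) (reflected-suc n) (ψ-shift n) (interior-vanishes₀ n) (reflected-interior n) k

    symmetric⇔Gorenstein : ∀ n → (∃[ D ] ∀ k → P n k ≡ P n (D - k)) ⇔ Gorenstein n
    symmetric⇔Gorenstein n = mk⇔ to from
      where
      open ≡-Reasoning
      x = + n * + S n
      +-shift : ∀ C k s → k - s + C ≡ k + C - s
      +-shift = solve-∀
      to : (∃[ D ] ∀ k → P n k ≡ P n (D - k)) → Gorenstein n
      -- Below the smaller of 0 and -C both sides vanish, the translated interior because k + C < 0.
      to (D , eq) = C , λ k → ℤ.+-injective (Δ-injective (S n) n Δ≡ (0ℤ ℤ.⊓ (- C)) below k)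
        where
        C = x - D
        reflect : ∀ x D k → D - k ≡ x - (k + (x - D))
        reflect = solve-∀
        Δ≡ : ∀ k → Δ (S n) n (+_ ∘ cone n) k ≡ Δ (S n) n (λ j → + interior n (j + C)) k
        Δ≡ k = begin
          Δ (S n) n (+_ ∘ cone n) k                  ≡⟨ P-cone n k ⟨
          + P n k                                    ≡⟨ cong +_ (eq k) ⟩
          + P n (D - k)                              ≡⟨ cong (+_ ∘ P n) (reflect x D k) ⟩
          reflected n (k + C)                        ≡⟨ reflected-interior n (k + C) ⟩
          Δ (S n) n (+_ ∘ interior n) (k + C)        ≡⟨ Δ-∘ n {λ j → j + C} {+_ ∘ interior n} (λ k → +-shift C k (+ S n)) (λ _ → refl) k ⟨
          Δ (S n) n (λ j → + interior n (j + C)) k   ∎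
        below : ∀ k → k < 0ℤ ℤ.⊓ (- C) → + cone n k ≡ + interior n (k + C)
        below k lt = cong +_ (trans (cone-vanishes n k (ℤ.<-≤-trans lt (ℤ.i⊓j≤i 0ℤ (- C))))
          (sym (interior-vanishes₀ n (k + C)
            (subst (k + C <_) (ℤ.+-inverseˡ C) (ℤ.+-monoˡ-< C (ℤ.<-≤-trans lt (ℤ.i⊓j≤j 0ℤ (- C))))))))
      from : Gorenstein n → ∃[ D ] ∀ k → P n k ≡ P n (D - k)
      from (C , eq) = x - C , λ k → ℤ.+-injective (begin
        + P n k                              ≡⟨ P-cone n k ⟩
        Δ (S n) n (+_ ∘ cone n) k            ≡⟨ Δ-∘ n {λ j → j + C} {+_ ∘ interior n} (λ k → +-shift C k (+ S n)) (λ k → cong +_ (eq k)) k ⟩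
        Δ (S n) n (+_ ∘ interior n) (k + C)  ≡⟨ reflected-interior n (k + C) ⟨
        + P n (x - (k + C))                  ≡⟨ cong (+_ ∘ P n) (reflect x C k) ⟩
        + P n (x - C - k)                    ∎)
        where
        reflect : ∀ x C k → x - (k + C) ≡ x - C - k
        reflect = solve-∀

    Palindromic⇔Gorenstein : ∀ n → Palindromic (P (suc n) ∘ +_) ⇔ Gorenstein (suc n)
    Palindromic⇔Gorenstein n = mk⇔
      (⇒ (symmetric⇔Gorenstein (suc n)) ∘ ⇒ palindromic⇔)
      (⇐ palindromic⇔ ∘ ⇐ (symmetric⇔Gorenstein (suc n)))
      where
      open Equivalence using () renaming (to to ⇒; from to ⇐)
      initial : ∀ k → k < + S (suc n) → P (suc n) k ≡ cone (suc n) k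
      initial k lt = ℤ.+-injective (trans (P-cone (suc n) k)
        (Δ-initial (S (suc n)) (suc n) (λ k k<0 → cong +_ (cone-vanishes (suc n) k k<0)) k lt))
      palindromic⇔ = Palindromic⇔symmetric (P (suc n))
        (λ k k<0 → trans (initial k (ℤ.<-≤-trans k<0 (ℤ.+≤+ ℕ.z≤n))) (cone-vanishes (suc n) k k<0))
        (λ eq → ℕ.<⇒≢ (cone-positive n ℤ.≤-refl)
          (trans (sym eq) (initial 0ℤ (ℤ.+<+ (ℕ.>-nonZero⁻¹ (S (suc n)))))))

-- Lattice points of the half-open parallelepiped

toℚᵘ-/ : ∀ z d .{{_ : NonZero d}} → toℚᵘ (z / d) ℚᵘ.≃ (z ℚᵘ./ d)
toℚᵘ-/ z (suc d) = ℚ.toℚᵘ-fromℚᵘ (mkℚᵘ z d)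

/-≤⁺ : ∀ a b c d .{{_ : NonZero c}} .{{_ : NonZero d}} → a * + d ≤ b * + c → a / c ℚ.≤ b / d
/-≤⁺ a b c@(suc _) d@(suc _) le = ℚ.toℚᵘ-cancel-≤
  (ℚᵘ.≤-respʳ-≃ (ℚᵘ.≃-sym (toℚᵘ-/ b d)) (ℚᵘ.≤-respˡ-≃ (ℚᵘ.≃-sym (toℚᵘ-/ a c)) (*≤* le)))

/-≤⁻ : ∀ a b c d .{{_ : NonZero c}} .{{_ : NonZero d}} → a / c ℚ.≤ b / d → a * + d ≤ b * + c
/-≤⁻ a b c@(suc _) d@(suc _) le =
  ℚᵘ.drop-*≤* (ℚᵘ.≤-respʳ-≃ (toℚᵘ-/ b d) (ℚᵘ.≤-respˡ-≃ (toℚᵘ-/ a c) (ℚ.toℚᵘ-mono-≤ le)))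

/-<⁺ : ∀ a b c d .{{_ : NonZero c}} .{{_ : NonZero d}} → a * + d < b * + c → a / c ℚ.< b / d
/-<⁺ a b c d lt = ℚ.≰⇒> λ le → ℤ.<⇒≱ lt (/-≤⁻ b a d c le)

/-<⁻ : ∀ a b c d .{{_ : NonZero c}} .{{_ : NonZero d}} → a / c ℚ.< b / d → a * + d < b * + c
/-<⁻ a b c d lt = ℤ.≰⇒> λ le → ℚ.<-irrefl refl (ℚ.<-≤-trans lt (/-≤⁺ b a d c le))

/-*-cancel : ∀ z d .{{_ : NonZero d}} → (z / d) ℚ.* (+ d / 1) ≡ z / 1
/-*-cancel z d@(suc d-1) = ℚ.toℚᵘ-injective (begin
  toℚᵘ ((z / d) ℚ.* (+ d / 1))          ≈⟨ ℚ.toℚᵘ-homo-* (z / d) (+ d / 1) ⟩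
  toℚᵘ (z / d) ℚᵘ.* toℚᵘ (+ d / 1)      ≈⟨ ℚᵘ.*-cong (toℚᵘ-/ z d) (toℚᵘ-/ (+ d) 1) ⟩
  mkℚᵘ z d-1 ℚᵘ.* mkℚᵘ (+ d) 0          ≈⟨ *≡* (trans (ℤ.*-identityʳ _) (cong (λ k → z * + k) (sym (ℕ.*-identityʳ d)))) ⟩
  mkℚᵘ z 0                              ≈⟨ toℚᵘ-/ z 1 ⟨
  toℚᵘ (z / 1)                          ∎)
  where open import Relation.Binary.Reasoning.Setoid ℚᵘ.≃-setoid

/-+-1 : ∀ z d .{{_ : NonZero d}} → z / d ℚ.+ 1ℚ ≡ (z + + d) / d
/-+-1 z d@(suc d-1) = ℚ.toℚᵘ-injective (begin
  toℚᵘ (z / d ℚ.+ 1ℚ)           ≈⟨ ℚ.toℚᵘ-homo-+ (z / d) 1ℚ ⟩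
  toℚᵘ (z / d) ℚᵘ.+ toℚᵘ 1ℚ     ≈⟨ ℚᵘ.+-congˡ (toℚᵘ 1ℚ) (toℚᵘ-/ z d) ⟩
  mkℚᵘ z d-1 ℚᵘ.+ mkℚᵘ 1ℤ 0     ≈⟨ *≡* (trans (eq z (+ d)) (cong (λ k → (z + + d) * + k) (sym (ℕ.*-identityʳ d)))) ⟩
  mkℚᵘ (z + + d) d-1            ≈⟨ toℚᵘ-/ (z + + d) d ⟨
  toℚᵘ ((z + + d) / d)          ∎)
  where
  open import Relation.Binary.Reasoning.Setoid ℚᵘ.≃-setoid
  eq : ∀ z d → (z * 1ℤ + 1ℤ * d) * d ≡ (z + d) * d
  eq = solve-∀

*-/-unique : ∀ x z d .{{_ : NonZero d}} → z / 1 ≡ x ℚ.* (+ d / 1) → x ≡ z / d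
*-/-unique x z d eq = ℚ.≤-antisym (cancel (ℚ.≤-reflexive eq′)) (cancel (ℚ.≤-reflexive (sym eq′)))
  where
  eq′ : x ℚ.* (+ d / 1) ≡ (z / d) ℚ.* (+ d / 1)
  eq′ = trans (sym eq) (sym (/-*-cancel z d))
  cancel : ∀ {p q} → p ℚ.* (+ d / 1) ℚ.≤ q ℚ.* (+ d / 1) → p ℚ.≤ q
  cancel = ℚ.*-cancelʳ-≤-pos (+ d / 1) {{ℚ.normalize-pos d 1}}

/-cross : ∀ a b c d .{{_ : NonZero c}} .{{_ : NonZero d}} → + a / c ≡ + b / d → a ℕ.* d ≡ b ℕ.* c
/-cross a b c d eq = ℤ.+-injective (begin
  + (a ℕ.* d)   ≡⟨ ℤ.pos-* a d ⟩
  + a * + d     ≡⟨ ℤ.≤-antisym (/-≤⁻ (+ a) (+ b) c d (ℚ.≤-reflexive eq))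
                               (/-≤⁻ (+ b) (+ a) d c (ℚ.≤-reflexive (sym eq))) ⟩
  + b * + c     ≡⟨ ℤ.pos-* b c ⟨
  + (b ℕ.* c)   ∎)
  where open ≡-Reasoning

lowest-terms : ∀ a b p q .{{_ : NonZero b}} .{{_ : NonZero q}} → + a / b ≡ + p / q → Coprime p q →
               ∃[ h ] b ≡ h ℕ.* q × a ≡ h ℕ.* p
lowest-terms a b p q eq co
  with ℕ.divides h b≡ ← coprime-divisor (Coprime.sym co) (ℕ.divides a (sym (/-cross a p b q eq))) =
  h , b≡ , ℕ.*-cancelʳ-≡ a (h ℕ.* p) q (begin
    a ℕ.* q            ≡⟨ /-cross a p b q eq ⟩
    p ℕ.* b            ≡⟨ cong (p ℕ.*_) b≡ ⟩
    p ℕ.* (h ℕ.* q)    ≡⟨ ring₁ p h q ⟩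
    h ℕ.* p ℕ.* q      ∎)
  where
  open ≡-Reasoning
  ring₁ : ∀ p h q → p ℕ.* (h ℕ.* q) ≡ h ℕ.* p ℕ.* q
  ring₁ = ℕ-solve-∀

-- `q` divides `t`, so `c` and `e` agree modulo `q`.
congruence⇔ : ∀ {p e c q} B t → q ℕ.∣ t → c ≡ B ℕ.* t ℕ.+ e →
              (+ p * + e ≡ -1ℤ [mod q ]) ⇔ q ℕ.∣ p ℕ.* c ℕ.+ 1
congruence⇔ {p} {e} {c} {q} B t q∣t c≡ = mk⇔
  (λ q∣ → subst (q ℕ.∣_) (sym pc+1) (ℕ.∣m∣n⇒∣m+n q∣pBt (subst (q ℕ.∣_) abs q∣)))
  (λ q∣ → subst (q ℕ.∣_) (sym abs) (ℕ.∣m+n∣m⇒∣n (subst (q ℕ.∣_) pc+1 q∣) q∣pBt))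
  where
  abs : ℤ.∣ + p * + e - -1ℤ ∣ ≡ p ℕ.* e ℕ.+ 1
  abs = cong (λ z → ℤ.∣ z + 1ℤ ∣) (sym (ℤ.pos-* p e))
  q∣pBt : q ℕ.∣ p ℕ.* (B ℕ.* t)
  q∣pBt = ℕ.∣n⇒∣m*n p (ℕ.∣n⇒∣m*n B q∣t)
  pc+1 : p ℕ.* c ℕ.+ 1 ≡ p ℕ.* (B ℕ.* t) ℕ.+ (p ℕ.* e ℕ.+ 1)
  pc+1 = trans (cong (λ c → p ℕ.* c ℕ.+ 1) c≡) (ring₁ p (B ℕ.* t) e)
    where
    ring₁ : ∀ p x e → p ℕ.* (x ℕ.+ e) ℕ.+ 1 ≡ p ℕ.* x ℕ.+ (p ℕ.* e ℕ.+ 1)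
    ring₁ = ℕ-solve-∀

snoc : ∀ {A : Set} {n} → Vector A n → A → Vector A (suc n)
snoc {n = zero}  α a _       = a
snoc {n = suc n} α a zero    = α zero
snoc {n = suc n} α a (suc i) = snoc (α ∘ suc) a i

snoc-inject₁ : ∀ {A : Set} {n} (α : Vector A n) a i → snoc α a (inject₁ i) ≡ α i
snoc-inject₁ α a zero    = refl
snoc-inject₁ α a (suc i) = snoc-inject₁ (α ∘ suc) a i

snoc-fromℕ : ∀ {A : Set} {n} (α : Vector A n) a → snoc α a (fromℕ n) ≡ a
snoc-fromℕ {n = zero}  α a = refl
snoc-fromℕ {n = suc n} α a = snoc-fromℕ (α ∘ suc) a

lookup-∷ʳ-inject₁ : ∀ {A : Set} {n} (x : Vec A n) a i → lookup (x ∷ʳ a) (inject₁ i) ≡ lookup x i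
lookup-∷ʳ-inject₁ (_ ∷ _) a zero    = refl
lookup-∷ʳ-inject₁ (_ ∷ x) a (suc i) = lookup-∷ʳ-inject₁ x a i

lookup-∷ʳ-fromℕ : ∀ {A : Set} {n} (x : Vec A n) a → lookup (x ∷ʳ a) (fromℕ n) ≡ a
lookup-∷ʳ-fromℕ []      a = refl
lookup-∷ʳ-fromℕ (_ ∷ x) a = lookup-∷ʳ-fromℕ x a

-- Counting in filtered lists

module _ {A : Set} where

  count : ∀ {P : A → Set} → (∀ x → Dec (P x)) → List A → ℕ
  count P? xs = length (filter P? xs)

  count-split : ∀ {P R T : A → Set} (P? : ∀ x → Dec (P x)) (R? : ∀ x → Dec (R x)) (T? : ∀ x → Dec (T x)) →
                (∀ x → R x → P x) → (∀ x → T x ⇔ (P x × ¬ R x)) →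
                ∀ xs → count P? xs ≡ count R? xs ℕ.+ count T? xs
  count-split P? R? T? R⇒P T⇔ []       = refl
  count-split P? R? T? R⇒P T⇔ (x ∷ xs) with ih ← count-split P? R? T? R⇒P T⇔ xs | P? x | R? x | T? x
  ... | yes p | yes r | yes t = contradiction r (proj₂ (Equivalence.to (T⇔ x) t))
  ... | yes p | yes r | no ¬t = cong suc ih
  ... | yes p | no ¬r | yes t = trans (cong suc ih) (sym (ℕ.+-suc _ _))
  ... | yes p | no ¬r | no ¬t = contradiction (Equivalence.from (T⇔ x) (p , ¬r)) ¬t
  ... | no ¬p | yes r | _     = contradiction (R⇒P x r) ¬p
  ... | no ¬p | no ¬r | yes t = contradiction (proj₁ (Equivalence.to (T⇔ x) t)) ¬p
  ... | no ¬p | no ¬r | no ¬t = ih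

-- 0 for the empty vector, as if λ₀ = 0
end : ∀ {n} → Vec ℤ n → ℤ
end {zero}  _ = 0ℤ
end {suc n} x = Vec.last x

end-∷ʳ : ∀ {n} (x : Vec ℤ n) k → end (x ∷ʳ k) ≡ k
end-∷ʳ x k = Vec.last-∷ʳ k x

∷ʳ-surjective : ∀ {n} (y : Vec ℤ (suc n)) → ∃[ x ] y ≡ x ∷ʳ end y
∷ʳ-surjective y with Vec.initLast y
... | x , k , refl = x , refl

-- Appending `k` is a bijection from the points counted by `R?` to those ending in `k`. The two
-- resulting lists are free of repetitions and have the same members, hence are permutations of each
-- other.
count-∷ʳ : ∀ {n} {P R : Vec ℤ n → Set} {P′ : Vec ℤ (suc n) → Set} k (R? : ∀ x → Dec (R x)) {xs ys} →
           Unique xs → Unique ys → (∀ x → x ∈ xs ⇔ P x) → (∀ y → y ∈ ys ⇔ P′ y) →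
           (∀ x → P′ (x ∷ʳ k) ⇔ (P x × R x)) → count (λ y → end y ℤ.≟ k) ys ≡ count R? xs
count-∷ʳ {P′ = P′} k R? {xs} {ys} unique-xs unique-ys ∈xs⇔ ∈ys⇔ P′⇔ = begin
  length (filter k? ys)                  ≡⟨ ↭-length (∼bag⇒↭ (unique∧set⇒bag
                                              (Unique.filter⁺ k? unique-ys)
                                              (Unique.map⁺ (Vec.∷ʳ-injectiveˡ _ _) (Unique.filter⁺ R? unique-xs))
                                              (mk⇔ to from))) ⟩
  length (map (_∷ʳ k) (filter R? xs))    ≡⟨ List.length-map (_∷ʳ k) (filter R? xs) ⟩
  length (filter R? xs)                  ∎
  where
  open ≡-Reasoning
  open Equivalence using () renaming (to to ⇒; from to ⇐)
  k? : ∀ y → Dec (end y ≡ k)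
  k? y = end y ℤ.≟ k
  to : ∀ {y} → y ∈ filter k? ys → y ∈ map (_∷ʳ k) (filter R? xs)
  to {y} y∈ with y∈ys , refl ← ∈-filter⁻ k? {xs = ys} y∈ | x , y≡ ← ∷ʳ-surjective y
    with Px , Rx ← ⇒ (P′⇔ x) (subst P′ y≡ (⇒ (∈ys⇔ y) y∈ys)) =
    subst (_∈ map (_∷ʳ k) (filter R? xs)) (sym y≡)
      (∈-map⁺ (_∷ʳ k) (∈-filter⁺ R? (⇐ (∈xs⇔ x) Px) Rx))
  from : ∀ {y} → y ∈ map (_∷ʳ k) (filter R? xs) → y ∈ filter k? ys
  from y∈ with x , x∈ , refl ← ∈-map⁻ (_∷ʳ k) y∈ with x∈xs , Rx ← ∈-filter⁻ R? {xs = xs} x∈ =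
    ∈-filter⁺ k? (⇐ (∈ys⇔ (x ∷ʳ k)) (⇐ (P′⇔ x) (⇒ (∈xs⇔ x) x∈xs , Rx))) (end-∷ʳ x k)

-- Removing the last coordinate of a lattice point

module _ (s : ℕ → ℕ) {{s≢0 : ∀ {i} → NonZero (s i)}} where

  -- s₀ = 1 together with λ₀ = 0 makes the first coordinate an instance of the
  -- general step
  prepend : ℕ → ℕ
  prepend zero    = 1
  prepend (suc n) = s n

  prepend-nonZero : ∀ {n} → NonZero (prepend n)
  prepend-nonZero {zero}  = _
  prepend-nonZero {suc n} = s≢0

  -- The range 0 ≤ α < 1 of the new coefficient, that is l / sₙ ≤ k / sₙ₊₁ < l / sₙ + 1, with
  -- denominators cleared; `prepend n` is sₙ and `s n` is sₙ₊₁.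
  Step : ℕ → ℤ → ℤ → Set
  Step n l k = l * + s n ≤ k * + prepend n × k * + prepend n < (l + + prepend n) * + s n

  step? : ∀ n l k → Dec (Step n l k)
  step? n l k = (_ ℤ.≤? _) ×-dec (_ ℤ.<? _)

  private
    weight : ∀ {n} → Vector ℚ n → Fin n → ℚ
    weight α j = sum (λ i → α i ℚ.* (v s i j / 1))

  v-inject₁ : ∀ {n} (i j : Fin n) → v s (inject₁ i) (inject₁ j) ≡ v s i j
  v-inject₁ i j = cong₂ (λ a b → if a ℕ.≤ᵇ b then + s b else 0ℤ) (Fin.toℕ-inject₁ i) (Fin.toℕ-inject₁ j)

  v-fromℕ-inject₁ : ∀ {n} (j : Fin n) → v s (fromℕ n) (inject₁ j) ≡ 0ℤ
  v-fromℕ-inject₁ {n} j = cong (if_then + s (toℕ (inject₁ j)) else 0ℤ)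
    (dec-false (fromℕ n Fin.≤? inject₁ j) λ le →
      ℕ.<⇒≱ (Fin.toℕ<n j) (subst₂ ℕ._≤_ (Fin.toℕ-fromℕ n) (Fin.toℕ-inject₁ j) le))

  v-fromℕ : ∀ {n} (i : Fin (suc n)) → v s i (fromℕ n) ≡ + s n
  v-fromℕ {n} i = trans
    (cong (if_then + s (toℕ (fromℕ n)) else 0ℤ) (dec-true (i Fin.≤? fromℕ n) (Fin.≤fromℕ i)))
    (cong (λ k → + s k) (Fin.toℕ-fromℕ n))

  weight-inject₁ : ∀ {n} (α : Vector ℚ (suc n)) j → weight α (inject₁ j) ≡ weight (init α) j
  weight-inject₁ {n} α j = begin
    weight α (inject₁ j)
      ≡⟨ sum-init-last (λ i → α i ℚ.* (v s i (inject₁ j) / 1)) ⟩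
    sum (λ i → α (inject₁ i) ℚ.* (v s (inject₁ i) (inject₁ j) / 1)) ℚ.+ last α ℚ.* (v s (fromℕ n) (inject₁ j) / 1)
      ≡⟨ cong₂ ℚ._+_ (sum-cong-≗ (λ i → cong (λ z → α (inject₁ i) ℚ.* (z / 1)) (v-inject₁ i j)))
                     (trans (cong (λ z → last α ℚ.* (z / 1)) (v-fromℕ-inject₁ j)) (ℚ.*-zeroʳ (last α))) ⟩
    weight (init α) j ℚ.+ 0ℚ
      ≡⟨ ℚ.+-identityʳ _ ⟩
    weight (init α) j ∎
    where open ≡-Reasoning

  weight-fromℕ : ∀ {n} (α : Vector ℚ (suc n)) → weight α (fromℕ n) ≡ sum α ℚ.* (+ s n / 1)
  weight-fromℕ α = trans (sum-cong-≗ (λ i → cong (λ z → α i ℚ.* (z / 1)) (v-fromℕ i)))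
    (sym (*-distribʳ-sum _ α))

  -- Every vᵢ has the same last entry sₙ, so the last coordinate is sₙ times the sum of the
  -- coefficients.
  sum≡end/s : ∀ {n} (x : Vec ℤ n) ((α , _) : LatticePoint s x) →
              sum α ≡ (end x / prepend n) {{prepend-nonZero {n}}}
  sum≡end/s {zero}  x _            = refl
  sum≡end/s {suc n} y (α , _ , eq) with x , y≡ ← ∷ʳ-surjective y = *-/-unique (sum α) (end y) (s n)
    (begin
      end y / 1                                ≡⟨ cong (_/ 1) (lookup-∷ʳ-fromℕ x (end y)) ⟨
      lookup (x ∷ʳ end y) (fromℕ n) / 1        ≡⟨ cong (λ z → lookup z (fromℕ n) / 1) y≡ ⟨
      lookup y (fromℕ n) / 1                   ≡⟨ eq (fromℕ n) ⟩
      weight α (fromℕ n)                       ≡⟨ weight-fromℕ α ⟩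
      sum α ℚ.* (+ s n / 1)                    ∎)
    where open ≡-Reasoning

  -- The coefficient sum passes from l / sₙ to k / sₙ₊₁, so the new coefficient is their difference;
  -- the earlier coordinates do not involve it.
  LatticePoint-∷ʳ : ∀ {n} (x : Vec ℤ n) k → LatticePoint s (x ∷ʳ k) ⇔ (LatticePoint s x × Step n (end x) k)
  LatticePoint-∷ʳ {n} x k = mk⇔ to from
    where
    instance _ = prepend-nonZero {n}
    S = prepend n
    t = s n
    l/S = end x / S

    0≤⇔ : ∀ p a → 0ℚ ℚ.≤ a ⇔ p ℚ.≤ p ℚ.+ a
    0≤⇔ p a = mk⇔
      (λ le → subst (ℚ._≤ p ℚ.+ a) (ℚ.+-identityʳ p) (ℚ.+-monoʳ-≤ p le))
      (λ le → ℚ.≮⇒≥ λ lt → ℚ.<-irrefl refl (ℚ.<-≤-trans (ℚ.+-monoʳ-< p lt)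
        (subst (ℚ._≤ p ℚ.+ a) (sym (ℚ.+-identityʳ p)) le)))

    <1⇔ : ∀ p a → a ℚ.< 1ℚ ⇔ p ℚ.+ a ℚ.< p ℚ.+ 1ℚ
    <1⇔ p a = mk⇔ (ℚ.+-monoʳ-< p)
      (λ lt → ℚ.≰⇒> λ le → ℚ.<-irrefl refl (ℚ.<-≤-trans lt (ℚ.+-monoʳ-≤ p le)))

    bounds⇔ : ∀ a → l/S ℚ.+ a ≡ k / t → (0ℚ ℚ.≤ a × a ℚ.< 1ℚ) ⇔ Step n (end x) k
    bounds⇔ a eq = mk⇔
      (λ (0≤a , a<1) →
        /-≤⁻ (end x) k S t (subst (l/S ℚ.≤_) eq (Equivalence.to (0≤⇔ l/S a) 0≤a)) ,
        /-<⁻ k (end x + + S) t S (subst₂ ℚ._<_ eq (/-+-1 (end x) S) (Equivalence.to (<1⇔ l/S a) a<1)))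
      (λ (lo , hi) →
        Equivalence.from (0≤⇔ l/S a) (subst (l/S ℚ.≤_) (sym eq) (/-≤⁺ (end x) k S t lo)) ,
        Equivalence.from (<1⇔ l/S a)
          (subst₂ ℚ._<_ (sym eq) (sym (/-+-1 (end x) S)) (/-<⁺ k (end x + + S) t S hi)))

    to : LatticePoint s (x ∷ʳ k) → LatticePoint s x × Step n (end x) k
    to y∈@(α , b , eq) = x∈ , Equivalence.to (bounds⇔ (last α) total) (b (fromℕ n))
      where
      x∈ : LatticePoint s x
      x∈ = init α , b ∘ inject₁ , λ j →
        trans (cong (_/ 1) (sym (lookup-∷ʳ-inject₁ x k j))) (trans (eq (inject₁ j)) (weight-inject₁ α j))
      open ≡-Reasoning
      total : l/S ℚ.+ last α ≡ k / t
      total = begin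
        l/S ℚ.+ last α              ≡⟨ cong (ℚ._+ last α) (sum≡end/s x x∈) ⟨
        sum (init α) ℚ.+ last α     ≡⟨ sum-init-last α ⟨
        sum α                       ≡⟨ sum≡end/s (x ∷ʳ k) y∈ ⟩
        end (x ∷ʳ k) / t            ≡⟨ cong (_/ t) (end-∷ʳ x k) ⟩
        k / t                       ∎

    from : LatticePoint s x × Step n (end x) k → LatticePoint s (x ∷ʳ k)
    from (x∈@(α , b , eq) , st) = α′ , b′ , eq′
      where
      open ≡-Reasoning
      a = k / t ℚ.- l/S
      α′ = snoc α a
      cancel : ∀ p q → p ℚ.+ (q ℚ.- p) ≡ q
      cancel = +-*-Solver.solve 2 (λ p q → p :+ (q :- p) := q) refl
        where open +-*-Solver
      b′ : ∀ i → 0ℚ ℚ.≤ α′ i × α′ i ℚ.< 1ℚ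
      b′ i with view i
      ... | ‵inject₁ j rewrite snoc-inject₁ α a j = b j
      ... | ‵fromℕ rewrite snoc-fromℕ α a = Equivalence.from (bounds⇔ a (cancel l/S (k / t))) st
      eq′ : ∀ j → lookup (x ∷ʳ k) j / 1 ≡ weight α′ j
      eq′ i with view i
      ... | ‵inject₁ j = begin
        lookup (x ∷ʳ k) (inject₁ j) / 1    ≡⟨ cong (_/ 1) (lookup-∷ʳ-inject₁ x k j) ⟩
        lookup x j / 1                     ≡⟨ eq j ⟩
        weight α j                         ≡⟨ sum-cong-≗ (λ i → cong (ℚ._* (v s i j / 1)) (snoc-inject₁ α a i)) ⟨
        weight (init α′) j                 ≡⟨ weight-inject₁ α′ j ⟨
        weight α′ (inject₁ j)              ∎
      ... | ‵fromℕ = begin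
        lookup (x ∷ʳ k) (fromℕ n) / 1      ≡⟨ cong (_/ 1) (lookup-∷ʳ-fromℕ x k) ⟩
        k / 1                              ≡⟨ /-*-cancel k t ⟨
        k / t ℚ.* (+ t / 1)                ≡⟨ cong (ℚ._* (+ t / 1)) (cancel l/S (k / t)) ⟨
        (l/S ℚ.+ a) ℚ.* (+ t / 1)          ≡⟨ cong (λ z → (z ℚ.+ a) ℚ.* (+ t / 1)) (sum≡end/s x x∈) ⟨
        (sum α ℚ.+ a) ℚ.* (+ t / 1)        ≡⟨ cong₂ (λ y z → (y ℚ.+ z) ℚ.* (+ t / 1))
                                               (sum-cong-≗ (snoc-inject₁ α a)) (snoc-fromℕ α a) ⟨
        (sum (init α′) ℚ.+ last α′) ℚ.* (+ t / 1)
                                           ≡⟨ cong (ℚ._* (+ t / 1)) (sum-init-last α′) ⟨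
        sum α′ ℚ.* (+ t / 1)               ≡⟨ weight-fromℕ α′ ⟨
        weight α′ (fromℕ n)                ∎

  count-end : ℕ → ℤ → ℕ
  count-end n k = count (λ x → end x ℤ.≟ k) (latticePoints s n)

  count-end-suc : ∀ n k → count-end (suc n) k ≡ count (λ x → step? n (end x) k) (latticePoints s n)
  count-end-suc n k = count-∷ʳ k (λ x → step? n (end x) k)
    (latticePoints-unique s n) (latticePoints-unique s (suc n))
    (∈-latticePoints s) (∈-latticePoints s) (λ x → LatticePoint-∷ʳ x k)

module _ {A B : Set} {P : A → Set} {R : B → Set} (P? : ∀ x → Dec (P x)) (R? : ∀ x → Dec (R x)) where

  count-tabulate-cong : ∀ {n} (f : Fin n → A) (g : Fin n → B) → (∀ i → P (f i) ⇔ R (g i)) →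
                        count P? (tabulate f) ≡ count R? (tabulate g)
  count-tabulate-cong {zero}  f g P⇔R = refl
  count-tabulate-cong {suc n} f g P⇔R
    with ih ← count-tabulate-cong (f ∘ suc) (g ∘ suc) (P⇔R ∘ suc) | P? (f zero) | R? (g zero)
  ... | yes _ | yes _ = cong suc ih
  ... | yes p | no ¬r = contradiction (Equivalence.to (P⇔R zero) p) ¬r
  ... | no ¬p | yes r = contradiction (Equivalence.from (P⇔R zero) r) ¬p
  ... | no _  | no _  = ih

count-tabulate-last : ∀ {A : Set} {P : A → Set} (P? : ∀ x → Dec (P x)) {n} (f : Fin (suc n) → A) →
  count P? (tabulate f) ≡ count P? (tabulate (f ∘ inject₁)) ℕ.+ count P? (f (fromℕ n) ∷ [])
count-tabulate-last P? {zero}  f = refl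
count-tabulate-last P? {suc n} f with P? (f zero)
... | yes _ = cong suc (count-tabulate-last P? (f ∘ suc))
... | no  _ = count-tabulate-last P? (f ∘ suc)

-- Window recursion for the point counts

module _ (s : ℕ → ℕ) {{s≢0 : ∀ {i} → NonZero (s i)}} where

  open Counts (prepend s) {{λ {n} → prepend-nonZero s {n}}}

  count-end-zero : ∀ k → count-end s 0 k ≡ δ₀ k
  count-end-zero (+ zero)  = refl
  count-end-zero (+ suc _) = refl
  count-end-zero -[1+ _ ]  = refl

  private
    count-≤ : ℕ → ℤ → ℤ
    count-≤ n j = + count (λ x → end x ℤ.≤? j) (latticePoints s n)

    difference : ∀ {a b c} → a ≡ b ℕ.+ c → + c ≡ + a - + b
    difference {b = b} {c} refl = eq (+ b) (+ c)
      where
      eq : ∀ b c → c ≡ b + c - b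
      eq = solve-∀

  count-end-Δ : ∀ n k → + count-end s n k ≡ count-≤ n k - count-≤ n (k - 1ℤ)
  count-end-Δ n k = difference (count-split
    (λ x → end x ℤ.≤? k) (λ x → end x ℤ.≤? k - 1ℤ) (λ x → end x ℤ.≟ k)
    (λ x le → ℤ.<⇒≤ (≤-pred⇒< le))
    (λ x → mk⇔
      (λ { refl → ℤ.≤-refl , λ le → ℤ.<-irrefl refl (≤-pred⇒< le) })
      (λ (le , ≰) → ℤ.≤-antisym le (ℤ.≮⇒≥ (≰ ∘ <⇒≤-pred))))
    (latticePoints s n))

  -- The admissible `l` form the window of `prepend s n` consecutive integers that ends at `φ n k`.
  Step⇔ : ∀ n l k → Step s n l k ⇔ (l ≤ φ n k × ¬ l ≤ φ n k - + prepend s n)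
  Step⇔ n l k = mk⇔
    (λ (lo , hi) → /-greatest t lo , λ le → ℤ.<⇒≱ hi (/-bound t (restore l S (ℤ.+-monoˡ-≤ S le))))
    (λ (le , ≰) → /-bound t le , ℤ.≰⇒> λ hi → ≰
      (subst (_≤ φ n k - S) (cancel l S) (ℤ.+-monoˡ-≤ (- S) (/-greatest t {l + S} hi))))
    where
    t = s n
    S = + prepend s n
    cancel : ∀ l S → l + S - S ≡ l
    cancel = solve-∀
    restore : ∀ l S {y} → l + S ≤ y - S + S → l + S ≤ y
    restore l S {y} = subst (l + S ≤_) (eq y S)
      where
      eq : ∀ y S → y - S + S ≡ y
      eq = solve-∀

  -- The window count is a difference of values of `count-≤`, and `window-cong` replaces `count-≤`
  -- by any other antidifference `N`.
  count-end-window : ∀ n (N : ℤ → ℤ) → (∀ k → + count-end s n k ≡ N k - N (k - 1ℤ)) →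
                     ∀ k → + count-end s (suc n) k ≡ N (φ n k) - N (φ n k - + prepend s n)
  count-end-window n N eq k = begin
    + count-end s (suc n) k
      ≡⟨ cong +_ (count-end-suc s n k) ⟩
    + count (λ x → step? s n (end x) k) (latticePoints s n)
      ≡⟨ difference (count-split
           (λ x → end x ℤ.≤? φ n k) (λ x → end x ℤ.≤? φ n k - + prepend s n) (λ x → step? s n (end x) k)
           (λ x le → ℤ.≤-trans le (ℤ.i-j≤i (φ n k) (+ prepend s n)))
           (λ x → Step⇔ n (end x) k)
           (latticePoints s n)) ⟩
    count-≤ n (φ n k) - count-≤ n (φ n k - + prepend s n)
      ≡⟨ window-cong {count-≤ n} {N} (λ k → trans (sym (count-end-Δ n k)) (eq k)) (prepend s n) (φ n k) ⟩
    N (φ n k) - N (φ n k - + prepend s n) ∎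
    where open ≡-Reasoning

  Q-palindromic⇔ : ∀ n → Palindromic (Q s (suc n)) ⇔ Gorenstein (suc n)
  Q-palindromic⇔ = Palindromic⇔Gorenstein (count-end s) count-end-zero count-end-window

  -- Ascents

  -- 0 for the empty sequence, as if e₀ = 0
  final : ∀ {n} → Vector ℕ n → ℕ
  final {zero}  e = 0
  final {suc n} e = last e

  Ascent-cong : ∀ {n} {e f : Vector ℕ n} → (∀ i → e i ≡ f i) → ∀ i → Ascent s e i → Ascent s f i
  Ascent-cong e≗f zero    = subst (0 ℕ.<_) (e≗f zero)
  Ascent-cong e≗f (suc i) = subst₂ (λ a b → + a / s (toℕ i) ℚ.< + b / s (suc (toℕ i)))
    (e≗f (inject₁ i)) (e≗f (suc i))

  asc-cong : ∀ {n} {e f : Vector ℕ n} → (∀ i → e i ≡ f i) → asc s e ≡ asc s f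
  asc-cong {e = e} {f} e≗f = count-tabulate-cong (ascent? s e) (ascent? s f) (λ i → i) (λ i → i)
    (λ i → mk⇔ (Ascent-cong e≗f i) (Ascent-cong (sym ∘ e≗f) i))

  Ascent-inject₁⇔ : ∀ {n} (e : Vector ℕ (suc n)) i → Ascent s e (inject₁ i) ⇔ Ascent s (init e) i
  Ascent-inject₁⇔ e zero    = mk⇔ (λ a → a) (λ a → a)
  Ascent-inject₁⇔ e (suc i) = mk⇔ (subst Asc (Fin.toℕ-inject₁ i)) (subst Asc (sym (Fin.toℕ-inject₁ i)))
    where
    Asc : ℕ → Set
    Asc k = + e (inject₁ (inject₁ i)) / s k ℚ.< + e (suc (inject₁ i)) / s (suc k)

  -- The ascent condition with denominators cleared. The conventions e₀ = 0 and s₀ = 1 bring the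
  -- ascent at position 0, e₁ > 0, under the same inequality.
  LastAscent : ∀ {n} → Vector ℕ (suc n) → Set
  LastAscent {n} e = final (init e) ℕ.* s n ℕ.< last e ℕ.* prepend s n

  Ascent-fromℕ⇔ : ∀ {n} (e : Vector ℕ (suc n)) → Ascent s e (fromℕ n) ⇔ LastAscent e
  Ascent-fromℕ⇔ {zero}  e = mk⇔ (subst (0 ℕ.<_) (sym (ℕ.*-identityʳ (e zero))))
                                (subst (0 ℕ.<_) (ℕ.*-identityʳ (e zero)))
  Ascent-fromℕ⇔ {suc m} e rewrite Fin.toℕ-fromℕ m = mk⇔
    (λ lt → ℤ.drop‿+<+ (subst₂ _<_ (sym (ℤ.pos-* a (s (suc m)))) (sym (ℤ.pos-* b (s m)))
      (/-<⁻ (+ a) (+ b) (s m) (s (suc m)) lt)))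
    (λ lt → /-<⁺ (+ a) (+ b) (s m) (s (suc m))
      (subst₂ _<_ (ℤ.pos-* a (s (suc m))) (ℤ.pos-* b (s m)) (ℤ.+<+ lt)))
    where
    a = e (inject₁ (fromℕ m))
    b = e (suc (fromℕ m))

  asc-init : ∀ {n} (e : Vector ℕ (suc n)) → asc s e ≡ asc s (init e) ℕ.+ count (ascent? s e) (fromℕ n ∷ [])
  asc-init {n} e = trans (count-tabulate-last (ascent? s e) (λ i → i))
    (cong (ℕ._+ count (ascent? s e) (fromℕ n ∷ []))
      (count-tabulate-cong (ascent? s e) (ascent? s (init e)) inject₁ (λ i → i) (Ascent-inject₁⇔ e)))

  asc-ascent : ∀ {n} (e : Vector ℕ (suc n)) → LastAscent e → asc s e ≡ suc (asc s (init e))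
  asc-ascent {n} e lt with ascent? s e (fromℕ n) | asc-init e
  ... | yes _ | eq = trans eq (ℕ.+-comm (asc s (init e)) 1)
  ... | no ¬a | _  = contradiction (Equivalence.from (Ascent-fromℕ⇔ e) lt) ¬a

  asc-nonascent : ∀ {n} (e : Vector ℕ (suc n)) → ¬ LastAscent e → asc s e ≡ asc s (init e)
  asc-nonascent {n} e ≮ with ascent? s e (fromℕ n) | asc-init e
  ... | yes a | _  = contradiction (Equivalence.to (Ascent-fromℕ⇔ e) a) ≮
  ... | no  _ | eq = trans eq (ℕ.+-identityʳ _)

  Inv-init : ∀ {n} {e : Vector ℕ (suc n)} → Inv s e → Inv s (init e)
  Inv-init {e = e} e∈ i = subst (λ k → e (inject₁ i) ℕ.< s k) (Fin.toℕ-inject₁ i) (e∈ (inject₁ i))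

  Inv-last : ∀ {n} {e : Vector ℕ (suc n)} → Inv s e → last e ℕ.< s n
  Inv-last {n} {e} e∈ = subst (λ k → last e ℕ.< s k) (Fin.toℕ-fromℕ n) (e∈ (fromℕ n))

  final<prepend : ∀ {n} {e : Vector ℕ n} → Inv s e → final e ℕ.< prepend s n
  final<prepend {zero}  _  = ℕ.≤-refl
  final<prepend {suc n} e∈ = Inv-last e∈

  -- With B non-ascents, n sₙ - (sₙ asc e - eₙ) = B sₙ + eₙ.
  least-bound : ∀ {n} (e : Vector ℕ n) → Inv s e →
                ∃[ B ] asc s e ℕ.+ B ≡ n × least n ℕ.≤ B ℕ.* prepend s n ℕ.+ final e
  least-bound {zero}  e e∈ = 0 , refl , ℕ.z≤n
  least-bound {suc n} e e∈ with B , eq , le ← least-bound (init e) (Inv-init e∈)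
                              | final (init e) ℕ.* s n ℕ.<? last e ℕ.* prepend s n
  ... | yes lt = B , trans (cong (ℕ._+ B) (asc-ascent e lt)) (cong suc eq) ,
    least-minimal n _ (begin-strict
      least n ℕ.* t                  ≤⟨ ℕ.*-monoˡ-≤ t le ⟩
      (B ℕ.* S ℕ.+ l) ℕ.* t          ≡⟨ ring₁ B S l t ⟩
      B ℕ.* t ℕ.* S ℕ.+ l ℕ.* t      <⟨ ℕ.+-monoʳ-< (B ℕ.* t ℕ.* S) lt ⟩
      B ℕ.* t ℕ.* S ℕ.+ last e ℕ.* S ≡⟨ ℕ.*-distribʳ-+ S (B ℕ.* t) (last e) ⟨
      (B ℕ.* t ℕ.+ last e) ℕ.* S     ∎)
    where
    open ℕ.≤-Reasoning
    S = prepend s n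
    t = s n
    l = final (init e)
    ring₁ : ∀ B S l t → (B ℕ.* S ℕ.+ l) ℕ.* t ≡ B ℕ.* t ℕ.* S ℕ.+ l ℕ.* t
    ring₁ = ℕ-solve-∀
  -- Without an ascent the strictness comes from eₙ < sₙ, at the cost of one more multiple of sₙ₊₁.
  ... | no ≮ = suc B , trans (ℕ.+-suc (asc s e) B) (cong suc (trans (cong (ℕ._+ B) (asc-nonascent e ≮)) eq)) ,
    least-minimal n _ (begin-strict
      least n ℕ.* t                       ≤⟨ ℕ.*-monoˡ-≤ t le ⟩
      (B ℕ.* S ℕ.+ l) ℕ.* t               <⟨ ℕ.*-monoˡ-< t (ℕ.+-monoʳ-< (B ℕ.* S) (final<prepend (Inv-init e∈))) ⟩
      (B ℕ.* S ℕ.+ S) ℕ.* t               ≡⟨ ring₁ B S t ⟩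
      suc B ℕ.* t ℕ.* S                   ≤⟨ ℕ.*-monoˡ-≤ S (ℕ.m≤m+n (suc B ℕ.* t) (last e)) ⟩
      (suc B ℕ.* t ℕ.+ last e) ℕ.* S      ∎)
    where
    open ℕ.≤-Reasoning
    S = prepend s n
    t = s n
    l = final (init e)
    ring₁ : ∀ B S t → (B ℕ.* S ℕ.+ S) ℕ.* t ≡ suc B ℕ.* t ℕ.* S
    ring₁ = ℕ-solve-∀

  -- Residues of the least interior degrees; this sequence attains the bound of `least-bound`.
  greedy : ∀ n → Vector ℕ n
  greedy n i = least (suc (toℕ i)) ℕ.% s (toℕ i)

  greedy-Inv : ∀ n → Inv s (greedy n)
  greedy-Inv n i = ℕ.m%n<n (least (suc (toℕ i))) (s (toℕ i))

  init-greedy : ∀ n i → init (greedy (suc n)) i ≡ greedy n i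
  init-greedy n i = cong (λ k → least (suc k) ℕ.% s k) (Fin.toℕ-inject₁ i)

  last-greedy : ∀ n → last (greedy (suc n)) ≡ least (suc n) ℕ.% s n
  last-greedy n = cong (λ k → least (suc k) ℕ.% s k) (Fin.toℕ-fromℕ n)

  final-cong : ∀ {n} {e f : Vector ℕ n} → (∀ i → e i ≡ f i) → final e ≡ final f
  final-cong {zero}  _   = refl
  final-cong {suc n} e≗f = e≗f (fromℕ n)

  least-greedy : ∀ n → ∃[ B ] asc s (greedy n) ℕ.+ B ≡ n × least n ≡ B ℕ.* prepend s n ℕ.+ final (greedy n)
  least-greedy zero = 0 , refl , refl
  least-greedy (suc n) with B , asc+B , c≡ ← least-greedy n = result (y ℕ.<? t)
    where
    instance _ = prepend-nonZero s {n}
    S = prepend s n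
    t = s n
    g = greedy (suc n)
    l = final (greedy n)
    -- The smallest value that would create an ascent after `l`. It never exceeds `t`; when it
    -- equals `t` it is too large for an entry, which becomes 0 while `B` grows by 1.
    y = suc ((l ℕ.* t) ℕ./ S)

    c′≡ : least (suc n) ≡ y ℕ.+ B ℕ.* t
    c′≡ = cong suc (begin
      (least n ℕ.* t) ℕ./ S                         ≡⟨ ℕ./-congˡ (trans (cong (ℕ._* t) c≡) (ring₁ B S l t)) ⟩
      (l ℕ.* t ℕ.+ B ℕ.* t ℕ.* S) ℕ./ S             ≡⟨ ℕ.+-distrib-/-∣ʳ (l ℕ.* t) (ℕ.n∣m*n (B ℕ.* t)) ⟩
      (l ℕ.* t) ℕ./ S ℕ.+ (B ℕ.* t ℕ.* S) ℕ./ S     ≡⟨ cong ((l ℕ.* t) ℕ./ S ℕ.+_) (ℕ.m*n/n≡m (B ℕ.* t) S) ⟩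
      (l ℕ.* t) ℕ./ S ℕ.+ B ℕ.* t                   ∎)
      where
      open ≡-Reasoning
      ring₁ : ∀ B S l t → (B ℕ.* S ℕ.+ l) ℕ.* t ≡ l ℕ.* t ℕ.+ B ℕ.* t ℕ.* S
      ring₁ = ℕ-solve-∀

    lt<yS : l ℕ.* t ℕ.< y ℕ.* S
    lt<yS = subst (ℕ._< y ℕ.* S) (sym (ℕ.m≡m%n+[m/n]*n (l ℕ.* t) S))
      (ℕ.+-monoˡ-< _ (ℕ.m%n<n (l ℕ.* t) S))

    y≤t : y ℕ.≤ t
    y≤t = ℕ.m<n*o⇒m/o<n {o = S} (subst (l ℕ.* t ℕ.<_) (ℕ.*-comm S t)
      (ℕ.*-monoˡ-< t (final<prepend (greedy-Inv n))))

    l≡ : final (init g) ≡ l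
    l≡ = final-cong (init-greedy n)

    asc≡ : asc s (init g) ≡ asc s (greedy n)
    asc≡ = asc-cong (init-greedy n)

    result : Dec (y ℕ.< t) → ∃[ B′ ] asc s g ℕ.+ B′ ≡ suc n × least (suc n) ≡ B′ ℕ.* t ℕ.+ last g
    result (yes y<t) = B ,
      trans (cong (ℕ._+ B) (trans (asc-ascent g ascent) (cong suc asc≡))) (cong suc asc+B) ,
      trans c′≡ (trans (ℕ.+-comm y _) (cong (B ℕ.* t ℕ.+_) (sym last≡)))
      where
      last≡ : last g ≡ y
      last≡ = trans (last-greedy n) (trans (ℕ.%-congˡ c′≡) (trans (ℕ.[m+kn]%n≡m%n y B t) (ℕ.m<n⇒m%n≡m y<t)))
      ascent : LastAscent g
      ascent = subst₂ (λ a b → a ℕ.* t ℕ.< b ℕ.* S) (sym l≡) (sym last≡) lt<yS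
    result (no y≮t) = suc B ,
      trans (ℕ.+-suc (asc s g) B)
        (cong suc (trans (cong (ℕ._+ B) (trans (asc-nonascent g nonascent) asc≡)) asc+B)) ,
      trans c′≡′ (trans (sym (ℕ.+-identityʳ _)) (cong (suc B ℕ.* t ℕ.+_) (sym last≡)))
      where
      c′≡′ : least (suc n) ≡ suc B ℕ.* t
      c′≡′ = trans c′≡ (cong (ℕ._+ B ℕ.* t) (ℕ.≤-antisym y≤t (ℕ.≮⇒≥ y≮t)))
      last≡ : last g ≡ 0
      last≡ = trans (last-greedy n) (trans (ℕ.%-congˡ c′≡′) (ℕ.m*n%n≡0 (suc B) t))
      nonascent : ¬ LastAscent g
      nonascent lt with () ← subst (λ b → final (init g) ℕ.* t ℕ.< b ℕ.* S) last≡ lt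

  -- `least-bound` gives one inequality. For the other, the objective at `e` is at least its value
  -- at `greedy`, where the bound is attained; counting non-ascents converts objectives into
  -- degrees.
  maximal⇒least : ∀ n (e : Vector ℕ (suc n)) → Inv s e →
    (∀ f → Inv s f → + s n * + asc s f - + last f ≤ + s n * + asc s e - + last e) →
    ∃[ B ] least (suc n) ≡ B ℕ.* s n ℕ.+ last e
  maximal⇒least n e e∈ maximal
    with B , asc+B , c≤ ← least-bound e e∈ | B′ , asc+B′ , c≡ ← least-greedy (suc n) =
    B , ℕ.≤-antisym c≤ (subst (B ℕ.* t ℕ.+ last e ℕ.≤_) (sym c≡)
      (ℕ.+-cancelˡ-≤ (t ℕ.* suc n) _ _ (begin
        t ℕ.* suc n ℕ.+ (B ℕ.* t ℕ.+ l)           ≡⟨ cong (λ k → t ℕ.* k ℕ.+ (B ℕ.* t ℕ.+ l)) asc+B′ ⟨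
        t ℕ.* (A′ ℕ.+ B′) ℕ.+ (B ℕ.* t ℕ.+ l)     ≡⟨ ring₁ t A′ B′ B l ⟩
        (t ℕ.* A′ ℕ.+ l) ℕ.+ (B ℕ.+ B′) ℕ.* t     ≤⟨ ℕ.+-monoˡ-≤ ((B ℕ.+ B′) ℕ.* t) cross ⟩
        (t ℕ.* A ℕ.+ l′) ℕ.+ (B ℕ.+ B′) ℕ.* t     ≡⟨ ring₂ t A B′ B l′ ⟩
        t ℕ.* (A ℕ.+ B) ℕ.+ (B′ ℕ.* t ℕ.+ l′)     ≡⟨ cong (λ k → t ℕ.* k ℕ.+ (B′ ℕ.* t ℕ.+ l′)) asc+B ⟩
        t ℕ.* suc n ℕ.+ (B′ ℕ.* t ℕ.+ l′)         ∎)))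
    where
    open ℕ.≤-Reasoning
    t = s n
    A = asc s e
    A′ = asc s (greedy (suc n))
    l = last e
    l′ = last (greedy (suc n))
    ring₁ : ∀ t A′ B′ B l → t ℕ.* (A′ ℕ.+ B′) ℕ.+ (B ℕ.* t ℕ.+ l) ≡ (t ℕ.* A′ ℕ.+ l) ℕ.+ (B ℕ.+ B′) ℕ.* t
    ring₁ = ℕ-solve-∀
    ring₂ : ∀ t A B′ B l′ → (t ℕ.* A ℕ.+ l′) ℕ.+ (B ℕ.+ B′) ℕ.* t ≡ t ℕ.* (A ℕ.+ B) ℕ.+ (B′ ℕ.* t ℕ.+ l′)
    ring₂ = ℕ-solve-∀
    move₁ : ∀ x y z → x - y + (y + z) ≡ x + z
    move₁ = solve-∀
    move₂ : ∀ x y z → x - z + (y + z) ≡ x + y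
    move₂ = solve-∀
    cross : t ℕ.* A′ ℕ.+ l ℕ.≤ t ℕ.* A ℕ.+ l′
    cross = ℤ.drop‿+≤+ (subst₂ _≤_
      (trans (move₁ (+ t * + A′) (+ l′) (+ l)) (cong (_+ + l) (sym (ℤ.pos-* t A′))))
      (trans (move₂ (+ t * + A) (+ l′) (+ l)) (cong (_+ + l′) (sym (ℤ.pos-* t A))))
      (ℤ.+-monoˡ-≤ (+ l′ + + l) (maximal (greedy (suc n)) (greedy-Inv (suc n)))))

  IsStar⇒least : ∀ m (e* : Vector ℕ (suc (suc m))) → IsStar s e* →
                 ∃[ B ] least (suc m) ≡ B ℕ.* s m ℕ.+ e* (inject₁ (fromℕ m))
  IsStar⇒least m e* star = subst (λ a → ∃[ B ] least (suc m) ≡ B ℕ.* s m ℕ.+ a) last≡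
    -- The longest proper prefix has m + 1 entries and ends in e*ₙ₋₁ for n = m + 2.
    (maximal⇒least m e′ e′∈ (prefix m m<1+m))
    where
    open IsStar star
    m<1+m = ℕ.n<1+n m
    embed : Fin (suc m) → Fin (suc (suc m))
    embed i = inject≤ i (ℕ.s≤s (ℕ.<⇒≤ m<1+m))
    e′ : Vector ℕ (suc m)
    e′ i = e* (embed i)
    e′∈ : Inv s e′
    e′∈ i = subst (λ k → e′ i ℕ.< s k) (Fin.toℕ-inject≤ i _) (inv (embed i))
    last≡ : last e′ ≡ e* (inject₁ (fromℕ m))
    last≡ = cong e* (Fin.toℕ-injective
      (trans (Fin.toℕ-inject≤ (fromℕ m) _) (sym (Fin.toℕ-inject₁ (fromℕ m)))))

  -- Palindromicity in consecutive dimensions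

  Gorenstein⇒least : ∀ n → Gorenstein (suc n) → ∀ k → cone (suc n) k ≡ interior (suc n) (k + + least (suc n))
  Gorenstein⇒least n (C , eq) with refl ← shift-unique n C eq = eq

  Q₁-palindromic : Palindromic (Q s 1)
  Q₁-palindromic = Equivalence.from (Q-palindromic⇔ 0) (1ℤ ,
    -- The step from dimension 0, where s₀ = 1: h = 1, p = s₁, q = 1 and the least degree is 0, so
    -- that x = 1 solves q x = p · 0 + 1.
    Gorenstein-suc 0 {1} {s 0} {1} refl (sym (ℕ.*-identityˡ (s 0))) 1
      (cong (ℕ._+ 1) (sym (ℕ.*-zeroʳ (s 0)))) (λ k → cong δ₀ (sym (ℤ.+-identityʳ k))))

  palindromic-suc⇔ : ∀ m {h p q} .{{_ : NonZero p}} → s m ≡ h ℕ.* q → s (suc m) ≡ h ℕ.* p → Coprime p q →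
    Palindromic (Q s (suc (suc m))) ⇔ (Palindromic (Q s (suc m)) × q ℕ.∣ p ℕ.* least (suc m) ℕ.+ 1)
  palindromic-suc⇔ m {h} {p} {q} sₘ sₘ₊₁ co = mk⇔ to from
    where
    open Equivalence using () renaming (to to ⇒; from to ⇐)
    instance
      h≢0 : NonZero h
      h≢0 = ℕ.m*n≢0⇒m≢0 h {{subst NonZero sₘ s≢0}}
    to : Palindromic (Q s (suc (suc m))) → Palindromic (Q s (suc m)) × q ℕ.∣ p ℕ.* least (suc m) ℕ.+ 1
    to pal = ⇐ (Q-palindromic⇔ m) (+ least (suc m) , Gorenstein-pred (suc m) G) ,
      ℕ.divides (least (suc (suc m))) (trans (sym (least-suc m {h} {p} {q} sₘ sₘ₊₁ co G)) (ℕ.*-comm q _))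
      where
      G = Gorenstein⇒least (suc m) (⇒ (Q-palindromic⇔ (suc m)) pal)
    from : Palindromic (Q s (suc m)) × q ℕ.∣ p ℕ.* least (suc m) ℕ.+ 1 → Palindromic (Q s (suc (suc m)))
    from (pal , ℕ.divides x px≡) = ⇐ (Q-palindromic⇔ (suc m)) (+ x ,
      Gorenstein-suc (suc m) {h} {p} {q} sₘ sₘ₊₁ x (trans (ℕ.*-comm q x) (sym px≡))
        (Gorenstein⇒least m (⇒ (Q-palindromic⇔ m) pal)))

theorem8p2 : (s : ℕ → ℕ) {{_ : ∀ {i} → NonZero (s i)}} →
    Palindromic (Q s 1) ×
    (∀ (m p q : ℕ) .{{_ : NonZero p}} .{{_ : NonZero q}} →
    + s (suc m) / s m ≡ + p / q → Coprime p q →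
    ∀ (e* : Vector ℕ (suc (suc m))) → IsStar s e* →
    Palindromic (Q s (suc (suc m))) ⇔
    (Palindromic (Q s (suc m)) × + p * + e* (inject₁ (fromℕ m)) ≡ -1ℤ [mod q ]))
theorem8p2 s = Q₁-palindromic s , λ m p q eq co e* star →
  let B , c≡ = IsStar⇒least s m e* star
      h , sₘ , sₘ₊₁ = lowest-terms (s (suc m)) (s m) p q eq co
      suc⇔ = palindromic-suc⇔ s m {h} {p} {q} sₘ sₘ₊₁ co
      mod⇔ = congruence⇔ {p} {e* (inject₁ (fromℕ m))} {_} {q} B (s m) (ℕ.divides h sₘ) c≡
  in mk⇔
    (λ pal → proj₁ (Equivalence.to suc⇔ pal) , Equivalence.from mod⇔ (proj₂ (Equivalence.to suc⇔ pal)))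
    (λ (pal , eq) → Equivalence.from suc⇔ (pal , Equivalence.to mod⇔ eq))
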